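{- Let $m\ge 2$. Let $Q$ be a nondegenerate quadratic form on $V=\mathbb{F}_3^{2m+1}$ with polar form $B(x,y)=Q(x+y)-Q(x)-Q(y)$. Let $\mathrm{NO}^+_{2m+1}(3)$ be the graph whose vertices are the $1$-dimensional subspaces $\langle x\rangle$ with $Q(x)\neq 0$ such that the restriction of $Q$ to $x^{\perp}=\{y: B(x,y)=0\}$ is of plus (hyperbolic) type, two distinct vertices $\langle x\rangle,\langle y\rangle$ being adjacent if $B(x,y)\neq 0$. Then $\mathrm{NO}^+_{2m+1}(3)$ is non-separating if and only if $m=2$.
   Context: A graph $\Gamma$ is separating if $\omega(\Gamma)\alpha(\Gamma)<|V(\Gamma)|$, where $\omega$ and $\alpha$ are the maximum clique and coclique sizes; non-separating otherwise. (This property is unchanged on passing to the complementary graph.) The graph has $\frac12 3^m(3^m+1)$ vertices. -}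

module Defs where

open import Data.Nat as ℕ using (ℕ; zero; suc; _≤_)
open import Data.Nat.DivMod using (_mod_)
open import Data.Fin using (Fin; toℕ) renaming (zero to fzero; suc to fsuc)
open import Data.Vec using (Vec; []; _∷_; zipWith; map; replicate; toList)
open import Data.List using (List; length)
open import Data.List.Relation.Unary.All using (All)
open import Data.List.Relation.Unary.Any using (Any)
open import Data.List.Relation.Unary.AllPairs using (AllPairs)
open import Data.Product using (Σ; _×_; ∃; ∃-syntax)
open import Relation.Binary.PropositionalEquality using (_≡_)
open import Relation.Nullary using (¬_)

F₃ : Set
F₃ = Fin 3

infixl 6 _+₃_ _-₃_
infixl 7 _*₃_

_+₃_ : F₃ → F₃ → F₃
a +₃ b = (toℕ a ℕ.+ toℕ b) mod 3

_*₃_ : F₃ → F₃ → F₃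
a *₃ b = (toℕ a ℕ.* toℕ b) mod 3

-₃_ : F₃ → F₃
-₃ a = (3 ℕ.∸ toℕ a) mod 3

_-₃_ : F₃ → F₃ → F₃
a -₃ b = a +₃ (-₃ b)

0₃ : F₃
0₃ = fzero

Vect : ℕ → Set
Vect n = Vec F₃ n

_⊕_ : ∀ {n} → Vect n → Vect n → Vect n
_⊕_ = zipWith _+₃_

_·_ : ∀ {n} → F₃ → Vect n → Vect n
c · v = map (c *₃_) v

𝟎 : ∀ {n} → Vect n
𝟎 = replicate _ 0₃

∑ : ∀ {k} → (Fin k → F₃) → F₃
∑ {zero}  f = 0₃
∑ {suc k} f = f fzero +₃ ∑ (λ i → f (fsuc i))

lookupV : ∀ {n} → Vect n → Fin n → F₃
lookupV (x ∷ xs) fzero    = x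
lookupV (x ∷ xs) (fsuc i) = lookupV xs i

lincomb : ∀ {n k} → Vec F₃ k → Vec (Vect n) k → Vect n
lincomb []       []       = 𝟎
lincomb (c ∷ cs) (v ∷ vs) = (c · v) ⊕ lincomb cs vs

LinIndep : ∀ {n k} → Vec (Vect n) k → Set
LinIndep {k = k} vs = ∀ (cs : Vec F₃ k) → lincomb cs vs ≡ 𝟎 → cs ≡ 𝟎

-- Quadratic forms on F₃ⁿ :  Q(x) = Σᵢ Σⱼ aᵢⱼ xᵢ xⱼ
-- (every homogeneous quadratic polynomial arises this way)

QuadForm : ℕ → Set
QuadForm n = Fin n → Fin n → F₃

evalQ : ∀ {n} → QuadForm n → Vect n → F₃
evalQ a x = ∑ (λ i → ∑ (λ j → a i j *₃ lookupV x i *₃ lookupV x j))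

polar : ∀ {n} → QuadForm n → Vect n → Vect n → F₃
polar Q x y = evalQ Q (x ⊕ y) -₃ evalQ Q x -₃ evalQ Q y

-- nondegenerate (odd characteristic): the radical of B is trivial
Nondegenerate : ∀ {n} → QuadForm n → Set
Nondegenerate {n} Q = ∀ (x : Vect n) → (∀ y → polar Q x y ≡ 0₃) → x ≡ 𝟎

Perp : ∀ {n} → QuadForm n → Vect n → Vect n → Set
Perp Q x y = polar Q x y ≡ 0₃

-- Restriction of Q to x^⊥ (a space of dimension 2m) is of plus
-- (hyperbolic) type: it is nondegenerate and has maximal Witt index m,
-- i.e. x^⊥ contains a totally singular subspace of dimension m.
PlusTypeOnPerp : ∀ {n} → (m : ℕ) → QuadForm n → Vect n → Set
PlusTypeOnPerp {n} m Q x =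
  (∀ (y : Vect n) → Perp Q x y →
     (∀ z → Perp Q x z → polar Q y z ≡ 0₃) → y ≡ 𝟎)
  × (∃[ vs ] (All (Perp Q x) (toList vs)
              × LinIndep {n} {m} vs
              × (∀ (cs : Vec F₃ m) → evalQ Q (lincomb cs vs) ≡ 0₃)))

-- Finite graphs whose vertices are given by representatives

record Graph : Set₁ where
  field
    Carrier  : Set
    IsVertex : Carrier → Set
    SameVertex : Carrier → Carrier → Set
    Adj      : Carrier → Carrier → Set

module _ (G : Graph) where
  open Graph G

  VertexList : List Carrier → Set
  VertexList L = All IsVertex L × AllPairs (λ x y → ¬ SameVertex x y) L

  IsClique : List Carrier → Set
  IsClique L = VertexList L × AllPairs Adj L

  IsCoclique : List Carrier → Set
  IsCoclique L = VertexList L × AllPairs (λ x y → ¬ Adj x y) L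

  IsCliqueNumber : ℕ → Set
  IsCliqueNumber k = (∃[ L ] (IsClique L × length L ≡ k))
                     × (∀ L → IsClique L → length L ≤ k)

  IsCocliqueNumber : ℕ → Set
  IsCocliqueNumber k = (∃[ L ] (IsCoclique L × length L ≡ k))
                       × (∀ L → IsCoclique L → length L ≤ k)

  HasOrder : ℕ → Set
  HasOrder N = ∃[ L ] (VertexList L × length L ≡ N
                       × (∀ x → IsVertex x → Any (SameVertex x) L))

  NonSeparating : Set
  NonSeparating = ∃[ ω ] ∃[ α ] ∃[ N ]
    (IsCliqueNumber ω × IsCocliqueNumber α × HasOrder N × N ≤ ω ℕ.* α)

-- The graph NO⁺_{2m+1}(3) for a quadratic form Q on F₃^{2m+1}.
-- Vertices: 1-spaces ⟨x⟩, represented by nonzero vectors x, with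
-- ⟨x⟩ = ⟨y⟩ iff y = c·x for some c ≠ 0.

NOPlus : (m : ℕ) → QuadForm (2 ℕ.* m ℕ.+ 1) → Graph
NOPlus m Q = record
  { Carrier    = Vect (2 ℕ.* m ℕ.+ 1)
  ; IsVertex   = λ x → ¬ x ≡ 𝟎 × ¬ evalQ Q x ≡ 0₃ × PlusTypeOnPerp m Q x
  ; SameVertex = λ x y → ∃[ c ] (¬ c ≡ 0₃ × y ≡ c · x)
  ; Adj        = λ x y → ¬ polar Q x y ≡ 0₃
  }

{-# OPTIONS --safe #-}

-- Gram-Schmidt and the isometries <1,1> = <-1,-1>, <d,d,d> = <1,-1,-d> give an orthogonal basis
-- (z, p₁, r₁, ..., p_m, r_m) with Q(z) = ε, Q(pᵢ) = 1, Q(rᵢ) = -1.  Reflections move z to any x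
-- with Q(x) = ε, so all these x are vertices, and counting solutions of Q = ε in coordinates shows
-- that there are at least 3^m (3^m + 1) / 2 vertices.  A coclique is an orthogonal set, so it has
-- at most 2m + 1 elements.  For a clique C put F(v) = Σ_{c ∈ C} (ζ^B(c,v) + ζ^-B(c,v)), ζ a cube
-- root of unity: distinct points give orthogonal functions, so Σ_v F(v)² = 2 · 3^(2m+1) |C|, while
-- F(v) = -|C| on the 2 |C| vectors of ± C.  Hence |C|² ≤ 3^(2m+1), which suffices for m ≥ 3.
-- For m = 2 every vertex has Q = ε, so there are at most 45, and explicit cliques of size 9 and
-- cocliques of size 5 exist.

module Submission where

open import Defs
open import Data.Bool using (if_then_else_)
open import Data.Empty using (⊥)
open import Data.Fin using (Fin; zero; suc)
open import Data.Fin.Properties using (_≟_; all?; any?)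
open import Data.Integer using (ℤ; +_; -[1+_]; -_; 0ℤ; 1ℤ; +≤+)
  renaming (_+_ to _+ℤ_; _*_ to _*ℤ_; _≤_ to _≤ℤ_)
import Data.Integer.Properties as ℤ
open import Data.Integer.Tactic.RingSolver using (solve-∀)
open import Data.List as List using (List; []; _∷_; _++_; length; filter; allFin; cartesianProductWith)
open import Data.List.Membership.Propositional using (_∈_; find)
open import Data.List.Membership.Propositional.Properties
  using (∈-∃++; ∈-++⁺ˡ; ∈-++⁺ʳ; ∈-++⁻; ∈-map⁺; ∈-map⁻; ∈-filter⁺; ∈-filter⁻; ∈-allFin; ∈-cartesianProductWith⁺)
open import Data.List.Properties using (length-++; length-map)
open import Data.List.Relation.Binary.Subset.Propositional using (_⊆_)
open import Data.List.Relation.Unary.All as All using (All; []; _∷_)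
import Data.List.Relation.Unary.All.Properties as All
open import Data.List.Relation.Unary.AllPairs as AllPairs using (AllPairs; []; _∷_)
import Data.List.Relation.Unary.AllPairs.Properties as AllPairs
open import Data.List.Relation.Unary.Any as Any using (here; there)
open import Data.List.Relation.Unary.Unique.Propositional using (Unique)
import Data.List.Relation.Unary.Unique.Propositional.Properties as Unique
open import Data.Nat using (ℕ; zero; suc; _≤_; _<_; _*_; _+_; _^_; z≤n; s≤s; >-nonZero)
import Data.Nat.Properties as ℕ
import Data.Nat.Tactic.RingSolver as ℕ-Solver
open import Data.Product using (_×_; _,_; ∃; ∃-syntax; proj₁; proj₂)
open import Data.Sum using (_⊎_; inj₁; inj₂)
open import Data.Vec as Vec using (Vec; []; _∷_; toList)
open import Data.Vec.Properties using (∷-injective; ≡-dec; length-toList; toList∘fromList)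
open import Data.Vec.Relation.Unary.All as VecAll using ([]; _∷_) renaming (All to VecAll)
open import Data.Vec.Relation.Unary.All.Properties using (toList⁺; toList⁻) renaming (map⁺ to VecAll-map⁺)
open import Function using (_∘_)
open import Function.Bundles using (_⇔_; mk⇔)
open import Relation.Binary.PropositionalEquality
open import Relation.Nullary using (¬_; Dec; yes; no; contradiction)
open import Relation.Nullary.Decidable
  using (True; toWitness; does; map′; decidable-stable; ¬?; _×-dec_; _→-dec_)

-- With t = 3^m, the bounds ω ≤ √3 t, α ≤ 2m+1 and N ≥ t(t+1)/2 refute N ≤ ωα as soon as 2√3 (2m+1)
-- < t+1. This holds from m = 3 on (24.25 against 28) and fails at m = 2, where 45 = 9 · 5 leaves no
-- slack and exact values are needed. The two directions call for opposite bounds on N. For m ≥ 3 it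
-- is enough that every vector of value ε gives a vertex. For m = 2, conversely, vectors of value -ε
-- must be excluded; one such vector with a perp of minus type suffices, because reflections carry
-- the type of the perp to all vectors of the same value. Dimension theory is replaced by the
-- pigeonhole principle on 3^k combinations inside 3^n vectors, and choices of vectors, cliques and
-- cocliques by finite search. Once a frame of shape (ε, 1, -1, 1, -1) is found, the checks for m =
-- 2 depend on the form only through ε.

1₃ 2₃ : F₃
1₃ = suc zero
2₃ = suc (suc zero)

private variable
  n k : ℕ

decide : {P : Set} (P? : Dec P) {_ : True P?} → P
decide P? {t} = toWitness t

-- Identities over F₃ are proved by evaluating all assignments of the variables.

module F₃-Identities where

  +-interchange : ∀ a b c d → (a +₃ b) +₃ (c +₃ d) ≡ (a +₃ c) +₃ (b +₃ d)
  +-interchange = decide (all? λ a → all? λ b → all? λ c → all? λ d → _ ≟ _)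

  +-comm : ∀ a b → a +₃ b ≡ b +₃ a
  +-comm = decide (all? λ a → all? λ b → _ ≟ _)

  +-assoc : ∀ a b c → (a +₃ b) +₃ c ≡ a +₃ (b +₃ c)
  +-assoc = decide (all? λ a → all? λ b → all? λ c → _ ≟ _)

  *-distribˡ : ∀ a b c → a *₃ (b +₃ c) ≡ a *₃ b +₃ a *₃ c
  *-distribˡ = decide (all? λ a → all? λ b → all? λ c → _ ≟ _)

  *-distribʳ : ∀ a b c → (a +₃ b) *₃ c ≡ a *₃ c +₃ b *₃ c
  *-distribʳ = decide (all? λ a → all? λ b → all? λ c → _ ≟ _)

  *-assoc : ∀ a b c → a *₃ b *₃ c ≡ a *₃ (b *₃ c)
  *-assoc = decide (all? λ a → all? λ b → all? λ c → _ ≟ _)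

  *-zeroʳ : ∀ a → a *₃ 0₃ ≡ 0₃
  *-zeroʳ = decide (all? λ a → _ ≟ _)

  *-identityˡ : ∀ a → 1₃ *₃ a ≡ a
  *-identityˡ = decide (all? λ a → _ ≟ _)

open F₃-Identities

-- The module F₃ⁿ

lookup-⊕ : ∀ (x y : Vect n) i → lookupV (x ⊕ y) i ≡ lookupV x i +₃ lookupV y i
lookup-⊕ (_ ∷ _) (_ ∷ _) zero    = refl
lookup-⊕ (_ ∷ x) (_ ∷ y) (suc i) = lookup-⊕ x y i

lookup-· : ∀ c (x : Vect n) i → lookupV (c · x) i ≡ c *₃ lookupV x i
lookup-· c (_ ∷ _) zero    = refl
lookup-· c (_ ∷ x) (suc i) = lookup-· c x i

⊕-interchange : ∀ (x y z w : Vect n) → (x ⊕ y) ⊕ (z ⊕ w) ≡ (x ⊕ z) ⊕ (y ⊕ w)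
⊕-interchange []      []      []      []      = refl
⊕-interchange (a ∷ x) (b ∷ y) (c ∷ z) (d ∷ w) =
  cong₂ _∷_ (+-interchange a b c d) (⊕-interchange x y z w)

⊕-comm : ∀ (x y : Vect n) → x ⊕ y ≡ y ⊕ x
⊕-comm []      []      = refl
⊕-comm (a ∷ x) (b ∷ y) = cong₂ _∷_ (+-comm a b) (⊕-comm x y)

⊕-assoc : ∀ (x y z : Vect n) → (x ⊕ y) ⊕ z ≡ x ⊕ (y ⊕ z)
⊕-assoc []      []      []      = refl
⊕-assoc (a ∷ x) (b ∷ y) (c ∷ z) = cong₂ _∷_ (+-assoc a b c) (⊕-assoc x y z)

⊕-identityˡ : ∀ (x : Vect n) → 𝟎 ⊕ x ≡ x
⊕-identityˡ []      = refl
⊕-identityˡ (a ∷ x) = cong₂ _∷_ (decide (all? λ a → 0₃ +₃ a ≟ a) a) (⊕-identityˡ x)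

⊕-inverseʳ : ∀ (x : Vect n) → x ⊕ (2₃ · x) ≡ 𝟎
⊕-inverseʳ []      = refl
⊕-inverseʳ (a ∷ x) = cong₂ _∷_ (decide (all? λ a → a +₃ 2₃ *₃ a ≟ 0₃) a) (⊕-inverseʳ x)

⊕-identityʳ : ∀ (x : Vect n) → x ⊕ 𝟎 ≡ x
⊕-identityʳ x = trans (⊕-comm x 𝟎) (⊕-identityˡ x)

·-distrib-⊕ : ∀ c (x y : Vect n) → c · (x ⊕ y) ≡ (c · x) ⊕ (c · y)
·-distrib-⊕ c []      []      = refl
·-distrib-⊕ c (a ∷ x) (b ∷ y) = cong₂ _∷_ (*-distribˡ c a b) (·-distrib-⊕ c x y)

·-distrib-+ : ∀ c d (x : Vect n) → (c +₃ d) · x ≡ (c · x) ⊕ (d · x)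
·-distrib-+ c d []      = refl
·-distrib-+ c d (a ∷ x) = cong₂ _∷_ (*-distribʳ c d a) (·-distrib-+ c d x)

·-assoc : ∀ c d (x : Vect n) → (c *₃ d) · x ≡ c · (d · x)
·-assoc c d []      = refl
·-assoc c d (a ∷ x) = cong₂ _∷_ (*-assoc c d a) (·-assoc c d x)

·-identity : ∀ (x : Vect n) → 1₃ · x ≡ x
·-identity []      = refl
·-identity (a ∷ x) = cong₂ _∷_ (*-identityˡ a) (·-identity x)

·-𝟎 : ∀ n c → c · 𝟎 {n} ≡ 𝟎
·-𝟎 zero    c = refl
·-𝟎 (suc n) c = cong₂ _∷_ (*-zeroʳ c) (·-𝟎 n c)

0·-𝟎 : ∀ (x : Vect n) → 0₃ · x ≡ 𝟎
0·-𝟎 []      = refl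
0·-𝟎 (a ∷ x) = cong (_ ∷_) (0·-𝟎 x)

-- 2 = -1 in F₃.
⊕≡𝟎⇒ : ∀ (x y : Vect n) → x ⊕ y ≡ 𝟎 → x ≡ 2₃ · y
⊕≡𝟎⇒ x y e = begin
  x                    ≡⟨ ⊕-identityʳ x ⟨
  x ⊕ 𝟎                ≡⟨ cong (x ⊕_) (⊕-inverseʳ y) ⟨
  x ⊕ (y ⊕ (2₃ · y))     ≡⟨ ⊕-assoc x y _ ⟨
  (x ⊕ y) ⊕ (2₃ · y)     ≡⟨ cong (_⊕ (2₃ · y)) e ⟩
  𝟎 ⊕ (2₃ · y)           ≡⟨ ⊕-identityˡ _ ⟩
  2₃ · y               ∎
  where open ≡-Reasoning

⊕-cancelˡ : ∀ (x y z : Vect n) → x ⊕ y ≡ x ⊕ z → y ≡ z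
⊕-cancelˡ []      []      []      e = refl
⊕-cancelˡ (a ∷ x) (b ∷ y) (c ∷ z) e =
  cong₂ _∷_ (decide (all? λ a → all? λ b → all? λ c → (a +₃ b ≟ a +₃ c) →-dec (b ≟ c)) a b c (cong Vec.head e))
            (⊕-cancelˡ x y z (cong Vec.tail e))

lincomb-⊕ : ∀ (x y : Vec F₃ k) (vs : Vec (Vect n) k) →
            lincomb (x ⊕ y) vs ≡ lincomb x vs ⊕ lincomb y vs
lincomb-⊕ []      []      []       = sym (⊕-identityˡ 𝟎)
lincomb-⊕ (a ∷ x) (b ∷ y) (v ∷ vs) = trans
  (cong₂ _⊕_ (·-distrib-+ a b v) (lincomb-⊕ x y vs))
  (⊕-interchange (a · v) (b · v) (lincomb x vs) (lincomb y vs))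

lincomb-· : ∀ c (x : Vec F₃ k) (vs : Vec (Vect n) k) →
            lincomb (c · x) vs ≡ c · lincomb x vs
lincomb-· {n = n} c []      []       = sym (·-𝟎 n c)
lincomb-· c (a ∷ x) (v ∷ vs) = trans
  (cong₂ _⊕_ (·-assoc c a v) (lincomb-· c x vs))
  (sym (·-distrib-⊕ c (a · v) (lincomb x vs)))

-- Quadratic forms and their polar forms

∑-cong : ∀ {f g : Fin k → F₃} → (∀ i → f i ≡ g i) → ∑ f ≡ ∑ g
∑-cong {zero}  e = refl
∑-cong {suc k} e = cong₂ _+₃_ (e zero) (∑-cong (e ∘ suc))

∑-+ : ∀ (f g : Fin k → F₃) → ∑ (λ i → f i +₃ g i) ≡ ∑ f +₃ ∑ g
∑-+ {zero}  f g = refl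
∑-+ {suc k} f g = trans (cong (f zero +₃ g zero +₃_) (∑-+ (f ∘ suc) (g ∘ suc)))
                        (+-interchange (f zero) (g zero) _ _)

∑-* : ∀ c (f : Fin k → F₃) → ∑ (λ i → c *₃ f i) ≡ c *₃ ∑ f
∑-* {zero}  c f = sym (*-zeroʳ c)
∑-* {suc k} c f = trans (cong (c *₃ f zero +₃_) (∑-* c (f ∘ suc)))
                        (sym (*-distribˡ c (f zero) _))

module Bilinear (a : QuadForm n) where

  bil : Vect n → Vect n → F₃
  bil x y = ∑ λ i → ∑ λ j → a i j *₃ lookupV x i *₃ lookupV y j

  bil-⊕ˡ : ∀ x y z → bil (x ⊕ y) z ≡ bil x z +₃ bil y z
  bil-⊕ˡ x y z = trans (∑-cong λ i → trans (∑-cong λ j → step i j) (∑-+ {n} _ _)) (∑-+ {n} _ _)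
    where
    step : ∀ i j → _
    step i j = trans (cong (λ t → a i j *₃ t *₃ lookupV z j) (lookup-⊕ x y i))
      (decide (all? λ a → all? λ b → all? λ c → all? λ d →
        a *₃ (b +₃ c) *₃ d ≟ a *₃ b *₃ d +₃ a *₃ c *₃ d) (a i j) (lookupV x i) (lookupV y i) (lookupV z j))

  bil-⊕ʳ : ∀ x y z → bil x (y ⊕ z) ≡ bil x y +₃ bil x z
  bil-⊕ʳ x y z = trans (∑-cong λ i → trans (∑-cong λ j → step i j) (∑-+ {n} _ _)) (∑-+ {n} _ _)
    where
    step : ∀ i j → _
    step i j = trans (cong (a i j *₃ lookupV x i *₃_) (lookup-⊕ y z j))
      (*-distribˡ (a i j *₃ lookupV x i) (lookupV y j) (lookupV z j))

  bil-·ˡ : ∀ c x y → bil (c · x) y ≡ c *₃ bil x y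
  bil-·ˡ c x y = trans (∑-cong λ i → trans (∑-cong λ j → step i j) (∑-* {n} c _)) (∑-* {n} c _)
    where
    step : ∀ i j → _
    step i j = trans (cong (λ t → a i j *₃ t *₃ lookupV y j) (lookup-· c x i))
      (decide (all? λ a → all? λ b → all? λ c → all? λ d →
        a *₃ (b *₃ c) *₃ d ≟ b *₃ (a *₃ c *₃ d)) (a i j) c (lookupV x i) (lookupV y j))

  bil-·ʳ : ∀ c x y → bil x (c · y) ≡ c *₃ bil x y
  bil-·ʳ c x y = trans (∑-cong λ i → trans (∑-cong λ j → step i j) (∑-* {n} c _)) (∑-* {n} c _)
    where
    step : ∀ i j → _
    step i j = trans (cong (a i j *₃ lookupV x i *₃_) (lookup-· c y j))
      (decide (all? λ a → all? λ b → all? λ c → a *₃ (b *₃ c) ≟ b *₃ (a *₃ c))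
        (a i j *₃ lookupV x i) c (lookupV y j))

-- The laws through which the form is used from here on, so that coordinate sums stay folded. By
-- `B-self`, a vector is orthogonal to itself exactly when it is singular, 2 being invertible.
record QuadraticSpace (n : ℕ) : Set where
  field
    q      : Vect n → F₃
    B      : Vect n → Vect n → F₃
    q-⊕    : ∀ x y → q (x ⊕ y) ≡ q x +₃ q y +₃ B x y
    q-·    : ∀ c x → q (c · x) ≡ c *₃ c *₃ q x
    B-sym  : ∀ x y → B x y ≡ B y x
    B-⊕ˡ   : ∀ x y z → B (x ⊕ y) z ≡ B x z +₃ B y z
    B-·ˡ   : ∀ c x y → B (c · x) y ≡ c *₃ B x y
    B-self : ∀ x → B x x ≡ 2₃ *₃ q x

  B-⊕ʳ : ∀ x y z → B x (y ⊕ z) ≡ B x y +₃ B x z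
  B-⊕ʳ x y z = trans (B-sym x (y ⊕ z)) (trans (B-⊕ˡ y z x) (cong₂ _+₃_ (B-sym y x) (B-sym z x)))

  B-·ʳ : ∀ c x y → B x (c · y) ≡ c *₃ B x y
  B-·ʳ c x y = trans (B-sym x (c · y)) (trans (B-·ˡ c y x) (cong (c *₃_) (B-sym y x)))

  q-𝟎 : q 𝟎 ≡ 0₃
  q-𝟎 = trans (cong q (sym (0·-𝟎 𝟎))) (q-· 0₃ 𝟎)

  B-𝟎ʳ : ∀ x → B x 𝟎 ≡ 0₃
  B-𝟎ʳ x = trans (cong (B x) (sym (0·-𝟎 𝟎))) (B-·ʳ 0₃ x 𝟎)

quadraticSpace : QuadForm n → QuadraticSpace n
quadraticSpace {n} a = record
  { q      = q
  ; B      = B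
  ; q-⊕    = λ x y → decide (all? λ a → all? λ b → all? λ c → a ≟ b +₃ c +₃ (a -₃ b -₃ c))
               (q (x ⊕ y)) (q x) (q y)
  ; q-·    = λ c x → trans (bil-·ˡ c x (c · x))
               (trans (cong (c *₃_) (bil-·ʳ c x x)) (sym (*-assoc c c (q x))))
  ; B-sym  = λ x y → trans (B-bil x y) (trans (+-comm (bil x y) (bil y x)) (sym (B-bil y x)))
  ; B-⊕ˡ   = λ x y z → trans (B-bil (x ⊕ y) z)
               (trans (cong₂ _+₃_ (bil-⊕ˡ x y z) (bil-⊕ʳ z x y))
               (trans (+-interchange (bil x z) (bil y z) (bil z x) (bil z y))
               (sym (cong₂ _+₃_ (B-bil x z) (B-bil y z)))))
  ; B-·ˡ   = λ c x y → trans (B-bil (c · x) y)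
               (trans (cong₂ _+₃_ (bil-·ˡ c x y) (bil-·ʳ c y x))
               (trans (sym (*-distribˡ c (bil x y) (bil y x)))
               (sym (cong (c *₃_) (B-bil x y)))))
  ; B-self = λ x → trans (B-bil x x) (decide (all? λ a → a +₃ a ≟ 2₃ *₃ a) (q x))
  }
  where
  open Bilinear a
  q : Vect n → F₃
  q = evalQ a
  B : Vect n → Vect n → F₃
  B = polar a
  -- The matrix `a` may be asymmetric, so `polar` is the symmetrization of `bil` rather than its
  -- double.
  B-bil : ∀ x y → B x y ≡ bil x y +₃ bil y x
  B-bil x y = trans
    (cong (λ t → t -₃ q x -₃ q y)
      (trans (bil-⊕ˡ x y (x ⊕ y)) (cong₂ _+₃_ (bil-⊕ʳ x x y) (bil-⊕ʳ y x y))))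
    (decide (all? λ a → all? λ b → all? λ c → all? λ d →
      (a +₃ b +₃ (c +₃ d)) -₃ a -₃ d ≟ b +₃ c) (bil x x) (bil x y) (bil y x) (bil y y))

-- Exhaustive search

Searchable : Set → Set₁
Searchable A = {P : A → Set} → (∀ x → Dec (P x)) → Dec (∃ P)

search-Vec : {A : Set} → Searchable A → ∀ k → Searchable (Vec A k)
search-Vec s zero    P? = map′ ([] ,_) (λ { ([] , p) → p }) (P? [])
search-Vec s (suc k) P? = map′ (λ (x , xs , p) → x ∷ xs , p) (λ { (x ∷ xs , p) → x , xs , p })
  (s λ x → search-Vec s k λ xs → P? (x ∷ xs))

search-Vect : ∀ n → Searchable (Vect n)
search-Vect = search-Vec any?

search⇒all? : {A : Set} → Searchable A → {P : A → Set} → (∀ x → Dec (P x)) → Dec (∀ x → P x)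
search⇒all? s P? = map′
  (λ ¬∃¬ x → decidable-stable (P? x) λ ¬p → ¬∃¬ (x , ¬p))
  (λ p (x , ¬p) → ¬p (p x))
  (¬? (s λ x → ¬? (P? x)))

-- Search downwards from the bound: as long as `P b` fails the bound can be lowered, and the given
-- witness stops the descent at 0 at the latest.
maximum : {P : ℕ → Set} → (∀ j → Dec (P j)) → ∀ b → (∀ j → P j → j ≤ b) → ∃ P →
          ∃[ j ] (P j × ∀ i → P i → i ≤ j)
maximum P? b bound (i , p) with P? b
... | yes pb = b , pb , bound
maximum P? zero    bound (i , p) | no ¬pb with z≤n ← bound i p = contradiction p ¬pb
maximum P? (suc b) bound (i , p) | no ¬pb =
  maximum P? b (λ j pj → ℕ.≤-pred (ℕ.≤∧≢⇒< (bound j pj) λ { refl → ¬pb pj })) (i , p)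

-- Sums over lists

module _ {A : Set} where

  sum : List A → (A → ℤ) → ℤ
  sum []      f = 0ℤ
  sum (x ∷ L) f = f x +ℤ sum L f

  sum-cong : ∀ L {f g : A → ℤ} → (∀ x → f x ≡ g x) → sum L f ≡ sum L g
  sum-cong []      e = refl
  sum-cong (x ∷ L) e = cong₂ _+ℤ_ (e x) (sum-cong L e)

  sum-++ : ∀ L M (f : A → ℤ) → sum (L ++ M) f ≡ sum L f +ℤ sum M f
  sum-++ []      M f = sym (ℤ.+-identityˡ _)
  sum-++ (x ∷ L) M f = trans (cong (f x +ℤ_) (sum-++ L M f)) (sym (ℤ.+-assoc (f x) _ _))

  sum-+ : ∀ L (f g : A → ℤ) → sum L (λ x → f x +ℤ g x) ≡ sum L f +ℤ sum L g
  sum-+ []      f g = refl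
  sum-+ (x ∷ L) f g = trans (cong (f x +ℤ g x +ℤ_) (sum-+ L f g)) (solve-swap (f x) (g x) _ _)
    where
    solve-swap : ∀ a b c d → a +ℤ b +ℤ (c +ℤ d) ≡ a +ℤ c +ℤ (b +ℤ d)
    solve-swap = solve-∀

  sum-* : ∀ L c (f : A → ℤ) → sum L (λ x → c *ℤ f x) ≡ c *ℤ sum L f
  sum-* []      c f = sym (ℤ.*-zeroʳ c)
  sum-* (x ∷ L) c f = trans (cong (c *ℤ f x +ℤ_) (sum-* L c f)) (sym (ℤ.*-distribˡ-+ c (f x) _))

  sum-const : ∀ (L : List A) c → sum L (λ _ → c) ≡ + length L *ℤ c
  sum-const []      c = refl
  sum-const (x ∷ L) c = trans (cong (c +ℤ_) (sum-const L c)) (sym (ℤ.suc-* (+ length L) c))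

  length≡sum : ∀ (L : List A) → + length L ≡ sum L (λ _ → 1ℤ)
  length≡sum L = sym (trans (sum-const L 1ℤ) (ℤ.*-identityʳ _))

  sum-nonneg : ∀ L {f : A → ℤ} → (∀ x → 0ℤ ≤ℤ f x) → 0ℤ ≤ℤ sum L f
  sum-nonneg []      f≥0 = ℤ.≤-refl
  sum-nonneg (x ∷ L) f≥0 = ℤ.+-mono-≤ (f≥0 x) (sum-nonneg L f≥0)

  -- The head of `L` occurs in `M`; that occurrence is deleted, and the rest of `L` stays within
  -- what remains because `L` has no repetitions. `M` may have some.
  sum-mono-⊆ : ∀ {L M} {f : A → ℤ} → (∀ x → 0ℤ ≤ℤ f x) → Unique L → L ⊆ M → sum L f ≤ℤ sum M f
  sum-mono-⊆ {M = M} f≥0 [] L⊆M = sum-nonneg M f≥0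
  sum-mono-⊆ {x ∷ L} {f = f} f≥0 (x∉L ∷ L!) L⊆M with ∈-∃++ (L⊆M (here refl))
  ... | M₁ , M₂ , refl = begin
    f x +ℤ sum L f                     ≤⟨ ℤ.+-monoʳ-≤ (f x) (sum-mono-⊆ f≥0 L! L⊆M₁M₂) ⟩
    f x +ℤ sum (M₁ ++ M₂) f            ≡⟨ cong (f x +ℤ_) (sum-++ M₁ M₂ f) ⟩
    f x +ℤ (sum M₁ f +ℤ sum M₂ f)     ≡⟨ solve-swap (f x) (sum M₁ f) (sum M₂ f) ⟩
    sum M₁ f +ℤ (f x +ℤ sum M₂ f)     ≡⟨ sum-++ M₁ (x ∷ M₂) f ⟨
    sum (M₁ ++ x ∷ M₂) f                ∎
    where
    open ℤ.≤-Reasoning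
    solve-swap : ∀ a b c → a +ℤ (b +ℤ c) ≡ b +ℤ (a +ℤ c)
    solve-swap = solve-∀
    L⊆M₁M₂ : L ⊆ M₁ ++ M₂
    L⊆M₁M₂ y∈L with ∈-++⁻ M₁ (L⊆M (there y∈L))
    ... | inj₁ y∈M₁         = ∈-++⁺ˡ y∈M₁
    ... | inj₂ (here refl)  = contradiction refl (All.lookup x∉L y∈L)
    ... | inj₂ (there y∈M₂) = ∈-++⁺ʳ M₁ y∈M₂

  pigeonhole : ∀ {L M : List A} → Unique L → L ⊆ M → length L ≤ length M
  pigeonhole {L} {M} L! L⊆M = ℤ.drop‿+≤+ (subst₂ _≤ℤ_ (sym (length≡sum L)) (sym (length≡sum M))
    (sum-mono-⊆ (λ _ → +≤+ z≤n) L! L⊆M))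

  χ : {P : A → Set} → (∀ x → Dec (P x)) → A → ℤ
  χ P? x = if does (P? x) then 1ℤ else 0ℤ

  length-filter≡sum : {P : A → Set} (P? : ∀ x → Dec (P x)) (L : List A) →
                      + length (filter P? L) ≡ sum L (χ P?)
  length-filter≡sum P? [] = refl
  length-filter≡sum P? (x ∷ L) with P? x
  ... | yes _ = cong (1ℤ +ℤ_) (length-filter≡sum P? L)
  ... | no  _ = trans (length-filter≡sum P? L) (sym (ℤ.+-identityˡ _))

sum-map : {A A′ : Set} (h : A → A′) (L : List A) (f : A′ → ℤ) → sum (List.map h L) f ≡ sum L (f ∘ h)
sum-map h []      f = refl
sum-map h (x ∷ L) f = cong (f (h x) +ℤ_) (sum-map h L f)

vects : ∀ n → List (Vect n)
vects zero    = [] ∷ []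
vects (suc n) = cartesianProductWith _∷_ (allFin 3) (vects n)

∈-vects : (x : Vect n) → x ∈ vects n
∈-vects []      = here refl
∈-vects (a ∷ x) = ∈-cartesianProductWith⁺ _∷_ (∈-allFin a) (∈-vects x)

vects-unique : ∀ n → Unique (vects n)
vects-unique zero    = [] ∷ []
vects-unique (suc n) = Unique.cartesianProductWith⁺ _∷_ ∷-injective (Unique.allFin⁺ 3) (vects-unique n)

length-vects : ∀ n → length (vects n) ≡ 3 ^ n
length-vects zero    = refl
length-vects (suc n) = begin
  length (map₀ ++ (map₁ ++ (map₂ ++ [])))              ≡⟨ length-++ map₀ ⟩
  length map₀ + length (map₁ ++ (map₂ ++ []))          ≡⟨ cong (λ t → length map₀ + t) (length-++ map₁) ⟩
  length map₀ + (length map₁ + length (map₂ ++ []))    ≡⟨ cong (λ t → length map₀ + (length map₁ + t)) (length-++ map₂) ⟩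
  length map₀ + (length map₁ + (length map₂ + 0))
    ≡⟨ cong₂ _+_ (length-map-∷ 0₃) (cong₂ _+_ (length-map-∷ 1₃) (cong (λ t → t + 0) (length-map-∷ 2₃))) ⟩
  3 * 3 ^ n                                            ∎
  where
  open ≡-Reasoning
  map₀ = List.map (0₃ ∷_) (vects n)
  map₁ = List.map (1₃ ∷_) (vects n)
  map₂ = List.map (2₃ ∷_) (vects n)
  length-map-∷ : ∀ a → length (List.map (a ∷_) (vects n)) ≡ 3 ^ n
  length-map-∷ a = trans (length-map (a ∷_) (vects n)) (length-vects n)

3^-cancel-≤ : ∀ i j → 3 ^ i ≤ 3 ^ j → i ≤ j
3^-cancel-≤ i j le = ℕ.≮⇒≥ λ j<i → ℕ.<⇒≱ (ℕ.^-monoʳ-< 3 (s≤s (s≤s z≤n)) j<i) le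

sum-vects : ∀ (f : Vect (suc n) → ℤ) → sum (vects (suc n)) f ≡
  sum (vects n) (f ∘ (0₃ ∷_)) +ℤ sum (vects n) (f ∘ (1₃ ∷_)) +ℤ sum (vects n) (f ∘ (2₃ ∷_))
sum-vects {n} f = begin
  sum (V₀ ++ (V₁ ++ (V₂ ++ []))) f                ≡⟨ sum-++ V₀ _ f ⟩
  sum V₀ f +ℤ sum (V₁ ++ (V₂ ++ [])) f            ≡⟨ cong (λ t → sum V₀ f +ℤ t) (sum-++ V₁ _ f) ⟩
  sum V₀ f +ℤ (sum V₁ f +ℤ sum (V₂ ++ []) f)
    ≡⟨ cong (λ t → sum V₀ f +ℤ (sum V₁ f +ℤ t)) (trans (sum-++ V₂ [] f) (ℤ.+-identityʳ _)) ⟩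
  sum V₀ f +ℤ (sum V₁ f +ℤ sum V₂ f)              ≡⟨ ℤ.+-assoc (sum V₀ f) _ _ ⟨
  sum V₀ f +ℤ sum V₁ f +ℤ sum V₂ f
    ≡⟨ cong₂ _+ℤ_ (cong₂ _+ℤ_ (sum-map (0₃ ∷_) V f) (sum-map (1₃ ∷_) V f)) (sum-map (2₃ ∷_) V f) ⟩
  sum V (f ∘ (0₃ ∷_)) +ℤ sum V (f ∘ (1₃ ∷_)) +ℤ sum V (f ∘ (2₃ ∷_))  ∎
  where
  open ≡-Reasoning
  V = vects n
  V₀ = List.map (0₃ ∷_) V
  V₁ = List.map (1₃ ∷_) V
  V₂ = List.map (2₃ ∷_) V

-- Adding `a` to the first coordinate permutes the three slices of `sum-vects` cyclically; inside a
-- slice the shorter vector acts by induction.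
sum-translate : ∀ (u : Vect n) (f : Vect n → ℤ) → sum (vects n) (λ v → f (u ⊕ v)) ≡ sum (vects n) f
sum-translate []              f = refl
sum-translate {suc n} (a ∷ u) f = begin
  sum (vects (suc n)) (λ v → f ((a ∷ u) ⊕ v))    ≡⟨ sum-vects {n} (λ v → f ((a ∷ u) ⊕ v)) ⟩
  s (a +₃ 0₃) +ℤ s (a +₃ 1₃) +ℤ s (a +₃ 2₃)
    ≡⟨ cong₂ _+ℤ_ (cong₂ _+ℤ_ (t (a +₃ 0₃)) (t (a +₃ 1₃))) (t (a +₃ 2₃)) ⟩
  r (a +₃ 0₃) +ℤ r (a +₃ 1₃) +ℤ r (a +₃ 2₃)     ≡⟨ rotate a ⟩
  r 0₃ +ℤ r 1₃ +ℤ r 2₃                         ≡⟨ sum-vects f ⟨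
  sum (vects (suc n)) f                          ∎
  where
  open ≡-Reasoning
  r s : F₃ → ℤ
  r b = sum (vects n) (λ v → f (b ∷ v))
  s b = sum (vects n) (λ v → f (b ∷ (u ⊕ v)))
  t : ∀ b → s b ≡ r b
  t b = sum-translate u (λ v → f (b ∷ v))
  rotate₁ : ∀ x y z → y +ℤ z +ℤ x ≡ x +ℤ y +ℤ z
  rotate₁ = solve-∀
  rotate₂ : ∀ x y z → z +ℤ x +ℤ y ≡ x +ℤ y +ℤ z
  rotate₂ = solve-∀
  rotate : ∀ a → r (a +₃ 0₃) +ℤ r (a +₃ 1₃) +ℤ r (a +₃ 2₃) ≡ r 0₃ +ℤ r 1₃ +ℤ r 2₃
  rotate zero             = refl
  rotate (suc zero)       = rotate₁ (r 0₃) (r 1₃) (r 2₃)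
  rotate (suc (suc zero)) = rotate₂ (r 0₃) (r 1₃) (r 2₃)

-- Orthogonal frames

dform : Vec F₃ k → Vect k → F₃
dform []       []       = 0₃
dform (d ∷ ds) (c ∷ cs) = d *₃ c *₃ c +₃ dform ds cs

module Frames (S : QuadraticSpace n) where
  open QuadraticSpace S public

  infix 4 _⟂_

  _⟂_ : Vect n → Vec (Vect n) k → Set
  y ⟂ vs = VecAll (λ v → B y v ≡ 0₃) vs

  -- The values of `q` form an index, so that a shape such as `ε ∷ hyp m` can be demanded of a
  -- frame. Orthogonality is recorded towards later vectors; symmetry of `B` supplies the rest.
  data Frame : Vec F₃ k → Vec (Vect n) k → Set where
    []    : Frame [] []
    frame : ∀ {d v} {ds : Vec F₃ k} {vs} → ¬ d ≡ 0₃ → q v ≡ d → v ⟂ vs → Frame ds vs →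
            Frame (d ∷ ds) (v ∷ vs)

  private variable
    ds : Vec F₃ k
    vs : Vec (Vect n) k

  ⟂-lincomb : ∀ {y} → y ⟂ vs → ∀ cs → B y (lincomb cs vs) ≡ 0₃
  ⟂-lincomb {y = y} []         []       = B-𝟎ʳ y
  ⟂-lincomb {vs = v ∷ vs} {y = y} (y⊥v ∷ y⟂vs) (c ∷ cs) = begin
    B y ((c · v) ⊕ lincomb cs vs)         ≡⟨ B-⊕ʳ y (c · v) _ ⟩
    B y (c · v) +₃ B y (lincomb cs vs)    ≡⟨ cong₂ _+₃_ (B-·ʳ c y v) (⟂-lincomb y⟂vs cs) ⟩
    c *₃ B y v +₃ 0₃                      ≡⟨ cong (λ t → c *₃ t +₃ 0₃) y⊥v ⟩
    c *₃ 0₃ +₃ 0₃                         ≡⟨ decide (all? λ c → c *₃ 0₃ +₃ 0₃ ≟ 0₃) c ⟩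
    0₃                                    ∎
    where open ≡-Reasoning

  ⟂-⊕ : ∀ {x y} → x ⟂ vs → y ⟂ vs → (x ⊕ y) ⟂ vs
  ⟂-⊕ {x = x} {y} x⟂ y⟂ = VecAll.map (λ { {v} (p , r) → trans (B-⊕ˡ x y v) (cong₂ _+₃_ p r) }) (VecAll.zip (x⟂ , y⟂))

  q-lincomb : Frame ds vs → ∀ cs → q (lincomb cs vs) ≡ dform ds cs
  q-lincomb [] [] = q-𝟎
  q-lincomb (frame {d = d} {v} {ds} {vs} _ qv v⟂vs F) (c ∷ cs) = begin
    q ((c · v) ⊕ l)                            ≡⟨ q-⊕ (c · v) l ⟩
    q (c · v) +₃ q l +₃ B (c · v) l
      ≡⟨ cong (λ t → q (c · v) +₃ q l +₃ t) (trans (B-·ˡ c v l) (cong (c *₃_) (⟂-lincomb v⟂vs cs))) ⟩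
    q (c · v) +₃ q l +₃ c *₃ 0₃
      ≡⟨ cong₂ (λ s t → s +₃ t +₃ c *₃ 0₃) (trans (q-· c v) (cong (c *₃ c *₃_) qv)) (q-lincomb F cs) ⟩
    c *₃ c *₃ d +₃ dform ds cs +₃ c *₃ 0₃
      ≡⟨ decide (all? λ c → all? λ d → all? λ e → c *₃ c *₃ d +₃ e +₃ c *₃ 0₃ ≟ d *₃ c *₃ c +₃ e) c d (dform ds cs) ⟩
    d *₃ c *₃ c +₃ dform ds cs                 ∎
    where
    open ≡-Reasoning
    l = lincomb cs vs

  B-lincomb-head : ∀ {d v} → q v ≡ d → v ⟂ vs → ∀ c cs → B v (lincomb (c ∷ cs) (v ∷ vs)) ≡ c *₃ (2₃ *₃ d)
  B-lincomb-head {vs = vs} {d} {v} qv v⟂vs c cs = begin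
    B v ((c · v) ⊕ lincomb cs vs)         ≡⟨ B-⊕ʳ v (c · v) _ ⟩
    B v (c · v) +₃ B v (lincomb cs vs)    ≡⟨ cong₂ _+₃_ (B-·ʳ c v v) (⟂-lincomb v⟂vs cs) ⟩
    c *₃ B v v +₃ 0₃                      ≡⟨ cong (λ t → c *₃ t +₃ 0₃) (trans (B-self v) (cong (2₃ *₃_) qv)) ⟩
    c *₃ (2₃ *₃ d) +₃ 0₃                  ≡⟨ decide (all? λ c → c +₃ 0₃ ≟ c) (c *₃ (2₃ *₃ d)) ⟩
    c *₃ (2₃ *₃ d)                        ∎
    where open ≡-Reasoning

  -- Pairing with the head `v` kills all later terms and multiplies the first coefficient by 2d,
  -- which is nonzero. So that coefficient is determined, and cancelling it leaves a shorter frame.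
  lincomb-injective : Frame ds vs → ∀ cs es → lincomb cs vs ≡ lincomb es vs → cs ≡ es
  lincomb-injective [] [] [] _ = refl
  lincomb-injective (frame {d = d} {v} {ds} {vs} d≢0 qv v⟂vs F) (c ∷ cs) (e ∷ es) eq
    with refl ← decide (all? λ c → all? λ e → all? λ d → (c *₃ (2₃ *₃ d) ≟ e *₃ (2₃ *₃ d)) →-dec (¬? (d ≟ 0₃) →-dec (c ≟ e)))
                  c e d (trans (sym (B-lincomb-head qv v⟂vs c cs)) (trans (cong (B v) eq) (B-lincomb-head qv v⟂vs e es))) d≢0
    = cong (c ∷_) (lincomb-injective F cs es (⊕-cancelˡ (c · v) _ _ eq))

  -- The 3^k combinations are distinct among 3^n vectors.
  frame-length≤ : Frame {k} ds vs → k ≤ n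
  frame-length≤ {k} {vs = vs} F = 3^-cancel-≤ k n (subst₂ _≤_
    (trans (length-map (λ cs → lincomb cs vs) (vects k)) (length-vects k)) (length-vects n)
    (pigeonhole (Unique.map⁺ (λ {cs es} → lincomb-injective F cs es) (vects-unique k)) (λ {x} _ → ∈-vects x)))

  orthogonalize : Frame ds vs → ∀ x → ∃[ cs ] (x ⊕ lincomb cs vs) ⟂ vs
  orthogonalize [] x = [] , []
  orthogonalize (frame {d = d} {v} {ds} {vs} d≢0 qv v⟂vs F) x with orthogonalize F x
  ... | cs , ⟂vs = c ∷ cs , head ∷ VecAll.map tail (VecAll.zip (⟂vs , v⟂vs))
    where
    open ≡-Reasoning
    -- Gram-Schmidt asks for -B(x,v)/(2d); over F₃ one has -1/2 = 1 and 1/d = d.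
    c = B x v *₃ d
    l = lincomb cs vs
    head : B (x ⊕ ((c · v) ⊕ l)) v ≡ 0₃
    head = begin
      B (x ⊕ ((c · v) ⊕ l)) v               ≡⟨ B-⊕ˡ x _ v ⟩
      B x v +₃ B ((c · v) ⊕ l) v            ≡⟨ cong (B x v +₃_) (trans (B-sym _ v) (B-lincomb-head qv v⟂vs c cs)) ⟩
      B x v +₃ B x v *₃ d *₃ (2₃ *₃ d)
        ≡⟨ decide (all? λ b → all? λ d → ¬? (d ≟ 0₃) →-dec (b +₃ b *₃ d *₃ (2₃ *₃ d) ≟ 0₃)) (B x v) d d≢0 ⟩
      0₃ ∎
    tail : ∀ {w} → B (x ⊕ l) w ≡ 0₃ × B v w ≡ 0₃ → B (x ⊕ ((c · v) ⊕ l)) w ≡ 0₃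
    tail {w} (p , r) = begin
      B (x ⊕ ((c · v) ⊕ l)) w               ≡⟨ B-⊕ˡ x _ w ⟩
      B x w +₃ B ((c · v) ⊕ l) w
        ≡⟨ cong (B x w +₃_) (trans (B-⊕ˡ (c · v) l w) (cong (_+₃ B l w) (trans (B-·ˡ c v w) (cong (c *₃_) r)))) ⟩
      B x w +₃ (c *₃ 0₃ +₃ B l w)
        ≡⟨ decide (all? λ b → all? λ c → all? λ e → b +₃ (c *₃ 0₃ +₃ e) ≟ b +₃ e) (B x w) c (B l w) ⟩
      B x w +₃ B l w                        ≡⟨ B-⊕ˡ x l w ⟨
      B (x ⊕ l) w                           ≡⟨ p ⟩
      0₃                                    ∎

  module _ (nondeg : ∀ x → (∀ y → B x y ≡ 0₃) → x ≡ 𝟎) where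

    -- If `q` vanishes on the complement of `vs`, polarization makes `B` vanish there too. By
    -- `orthogonalize` every vector is a complement vector plus a combination of `vs`, so the
    -- complement lies in the radical and is zero.
    extend⊎span : Frame ds vs → (∃[ y ] (y ⟂ vs × ¬ q y ≡ 0₃)) ⊎ (∀ x → ∃[ cs ] x ≡ lincomb cs vs)
    extend⊎span {vs = vs} F with search-Vect n (λ y → VecAll.all? (λ v → B y v ≟ 0₃) vs ×-dec ¬? (q y ≟ 0₃))
    ... | yes found = inj₁ found
    ... | no ¬found = inj₂ λ x → let cs , ⟂vs = orthogonalize F x in
      2₃ · cs , trans (⊕≡𝟎⇒ x _ (⟂⇒𝟎 ⟂vs)) (sym (lincomb-· 2₃ cs vs))
      where
      open ≡-Reasoning
      singular : ∀ {y} → y ⟂ vs → q y ≡ 0₃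
      singular {y} y⟂ = decidable-stable (q y ≟ 0₃) λ qy≢0 → ¬found (y , y⟂ , qy≢0)
      ⟂⇒𝟎 : ∀ {y} → y ⟂ vs → y ≡ 𝟎
      ⟂⇒𝟎 {y} y⟂ = nondeg y λ x → let cs , z⟂ = orthogonalize F x; z = x ⊕ lincomb cs vs in begin
        B y x                          ≡⟨ decide (all? λ b → b ≟ b +₃ 0₃) (B y x) ⟩
        B y x +₃ 0₃                    ≡⟨ cong (B y x +₃_) (⟂-lincomb y⟂ cs) ⟨
        B y x +₃ B y (lincomb cs vs)   ≡⟨ B-⊕ʳ y x _ ⟨
        B y z                          ≡⟨ decide (all? λ b → b ≟ 0₃ +₃ 0₃ +₃ b) (B y z) ⟩
        0₃ +₃ 0₃ +₃ B y z              ≡⟨ cong₂ (λ s t → s +₃ t +₃ B y z) (singular y⟂) (singular z⟂) ⟨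
        q y +₃ q z +₃ B y z            ≡⟨ q-⊕ y z ⟨
        q (y ⊕ z)                      ≡⟨ singular (⟂-⊕ y⟂ z⟂) ⟩
        0₃                             ∎

    extend : Frame {k} ds vs → k < n → ∃[ y ] (y ⟂ vs × ¬ q y ≡ 0₃)
    extend {k} {vs = vs} F k<n with extend⊎span F
    ... | inj₁ found = found
    ... | inj₂ span  = contradiction n≤k (ℕ.<⇒≱ k<n)
      where
      V⊆ : vects n ⊆ List.map (λ cs → lincomb cs vs) (vects k)
      V⊆ {x} _ with cs , refl ← span x = ∈-map⁺ _ (∈-vects cs)
      n≤k : n ≤ k
      n≤k = 3^-cancel-≤ n k
        (subst₂ _≤_ (length-vects n) (trans (length-map _ (vects k)) (length-vects k))
          (pigeonhole (vects-unique n) V⊆))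

    spanning : Frame {k} ds vs → n ≤ k → ∀ x → ∃[ cs ] x ≡ lincomb cs vs
    spanning F n≤k with extend⊎span F
    ... | inj₁ (y , y⟂ , qy≢0) = contradiction n≤k (ℕ.<⇒≱ (frame-length≤ (frame qy≢0 refl y⟂ F)))
    ... | inj₂ span            = span

-- Hyperbolic frames, reflections and perps of plus type

lincomb-𝟎 : (vs : Vec (Vect n) k) → lincomb 𝟎 vs ≡ 𝟎
lincomb-𝟎 []       = refl
lincomb-𝟎 (v ∷ vs) = trans (cong₂ _⊕_ (0·-𝟎 v) (lincomb-𝟎 vs)) (⊕-identityˡ 𝟎)

-- Diagonal form of an orthogonal sum of k hyperbolic planes, 2 standing for -1. With length
-- `k * 2`, passing to `suc k` reduces to two further entries.
hyp : ∀ k → Vec F₃ (k * 2)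
hyp zero    = []
hyp (suc k) = 1₃ ∷ 2₃ ∷ hyp k

dup : Vec F₃ k → Vec F₃ (k * 2)
dup []       = []
dup (c ∷ cs) = c ∷ c ∷ dup cs

-- An orthogonal pair p, r of values 1 and -1 has q(p + r) = 0, so these sums span a totally
-- singular space; `dup` gives its coefficients in the original frame.
addPairs : ∀ k → Vec (Vect n) (k * 2) → Vec (Vect n) k
addPairs zero    []           = []
addPairs (suc k) (p ∷ r ∷ vs) = (p ⊕ r) ∷ addPairs k vs

lincomb-addPairs : ∀ (cs : Vec F₃ k) (vs : Vec (Vect n) (k * 2)) →
                   lincomb cs (addPairs k vs) ≡ lincomb (dup cs) vs
lincomb-addPairs []       []           = refl
lincomb-addPairs (c ∷ cs) (p ∷ r ∷ vs) = trans
  (cong₂ _⊕_ (·-distrib-⊕ c p r) (lincomb-addPairs cs vs))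
  (⊕-assoc (c · p) (c · r) (lincomb (dup cs) vs))

dform-dup : (cs : Vec F₃ k) → dform (hyp k) (dup cs) ≡ 0₃
dform-dup []       = refl
dform-dup (c ∷ cs) = trans (cong (λ t → 1₃ *₃ c *₃ c +₃ (2₃ *₃ c *₃ c +₃ t)) (dform-dup cs))
  (decide (all? λ c → 1₃ *₃ c *₃ c +₃ (2₃ *₃ c *₃ c +₃ 0₃) ≟ 0₃) c)

dup≡𝟎 : (cs : Vec F₃ k) → dup cs ≡ 𝟎 → cs ≡ 𝟎
dup≡𝟎 []       e = refl
dup≡𝟎 (c ∷ cs) e = cong₂ _∷_ (cong Vec.head e) (dup≡𝟎 cs (cong (Vec.tail ∘ Vec.tail) e))

module Perp (S : QuadraticSpace n) where
  open Frames S public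

  -- For `quadraticSpace Q` this and `TotallySingularInPerp` unfold to the two halves of
  -- `PlusTypeOnPerp`.
  NondegenerateOnPerp : Vect n → Set
  NondegenerateOnPerp x = ∀ y → B x y ≡ 0₃ → (∀ z → B x z ≡ 0₃ → B y z ≡ 0₃) → y ≡ 𝟎

  TotallySingularInPerp : ℕ → Vect n → Set
  TotallySingularInPerp m x = ∃[ vs ] (All (λ y → B x y ≡ 0₃) (toList vs)
                                × LinIndep {n} {m} vs
                                × (∀ (cs : Vec F₃ m) → q (lincomb cs vs) ≡ 0₃))

  -- Every z is a vector of x^⊥ minus a multiple of `x`, and `y` is orthogonal to both parts; so the
  -- radical of x^⊥ lies in the radical of the whole space.
  nondegenerateOnPerp : (∀ x → (∀ y → B x y ≡ 0₃) → x ≡ 𝟎) → ∀ x → ¬ q x ≡ 0₃ → NondegenerateOnPerp x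
  nondegenerateOnPerp nondeg x qx≢0 y x⊥y y⊥x^⊥ = nondeg y λ z →
    let cs , z′⟂x = orthogonalize (frame qx≢0 refl [] []) z
        l = lincomb cs (x ∷ []) in begin
      B y z              ≡⟨ decide (all? λ b → b ≟ b +₃ 0₃) (B y z) ⟩
      B y z +₃ 0₃        ≡⟨ cong (B y z +₃_) (⟂-lincomb (trans (B-sym y x) x⊥y ∷ []) cs) ⟨
      B y z +₃ B y l     ≡⟨ B-⊕ʳ y z l ⟨
      B y (z ⊕ l)        ≡⟨ y⊥x^⊥ (z ⊕ l) (trans (B-sym x (z ⊕ l)) (VecAll.head z′⟂x)) ⟩
      0₃                 ∎
    where open ≡-Reasoning

  -- The reflection v - (B(v,s)/q(s)) s without division: -1 is 2, and a nonzero q(s) is its own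
  -- inverse. For singular `s` it is the identity.
  reflect : Vect n → Vect n → Vect n
  reflect s v = v ⊕ ((2₃ *₃ B v s *₃ q s) · s)

  reflect-⊕ : ∀ s v w → reflect s (v ⊕ w) ≡ reflect s v ⊕ reflect s w
  reflect-⊕ s v w = trans
    (cong (λ c → (v ⊕ w) ⊕ (c · s)) (trans (cong (λ t → 2₃ *₃ t *₃ q s) (B-⊕ˡ v w s))
      (decide (all? λ a → all? λ b → all? λ c → 2₃ *₃ (a +₃ b) *₃ c ≟ 2₃ *₃ a *₃ c +₃ 2₃ *₃ b *₃ c) (B v s) (B w s) (q s))))
    (trans (cong ((v ⊕ w) ⊕_) (·-distrib-+ (2₃ *₃ B v s *₃ q s) (2₃ *₃ B w s *₃ q s) s))
      (⊕-interchange v w ((2₃ *₃ B v s *₃ q s) · s) ((2₃ *₃ B w s *₃ q s) · s)))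

  reflect-· : ∀ s c v → reflect s (c · v) ≡ c · reflect s v
  reflect-· s c v = trans
    (cong (λ e → (c · v) ⊕ (e · s)) (trans (cong (λ t → 2₃ *₃ t *₃ q s) (B-·ˡ c v s))
      (decide (all? λ a → all? λ b → all? λ c → 2₃ *₃ (a *₃ b) *₃ c ≟ a *₃ (2₃ *₃ b *₃ c)) c (B v s) (q s))))
    (trans (cong ((c · v) ⊕_) (·-assoc c (2₃ *₃ B v s *₃ q s) s))
      (sym (·-distrib-⊕ c v ((2₃ *₃ B v s *₃ q s) · s))))

  reflect-𝟎 : ∀ s → reflect s 𝟎 ≡ 𝟎
  reflect-𝟎 s = trans (cong (reflect s) (sym (0·-𝟎 𝟎))) (trans (reflect-· s 0₃ 𝟎) (0·-𝟎 _))

  reflect-lincomb : ∀ s (cs : Vec F₃ k) vs → lincomb cs (Vec.map (reflect s) vs) ≡ reflect s (lincomb cs vs)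
  reflect-lincomb s []       []       = sym (reflect-𝟎 s)
  reflect-lincomb s (c ∷ cs) (v ∷ vs) = trans
    (cong₂ _⊕_ (sym (reflect-· s c v)) (reflect-lincomb s cs vs))
    (sym (reflect-⊕ s (c · v) (lincomb cs vs)))

  q-reflect : ∀ s v → q (reflect s v) ≡ q v
  q-reflect s v = begin
    q (v ⊕ (c · s))                              ≡⟨ q-⊕ v (c · s) ⟩
    q v +₃ q (c · s) +₃ B v (c · s)              ≡⟨ cong₂ (λ t u → q v +₃ t +₃ u) (q-· c s) (B-·ʳ c v s) ⟩
    q v +₃ c *₃ c *₃ q s +₃ c *₃ B v s
      ≡⟨ decide (all? λ a → all? λ b → all? λ d →
           a +₃ 2₃ *₃ b *₃ d *₃ (2₃ *₃ b *₃ d) *₃ d +₃ 2₃ *₃ b *₃ d *₃ b ≟ a) (q v) (B v s) (q s) ⟩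
    q v                                          ∎
    where
    open ≡-Reasoning
    c = 2₃ *₃ B v s *₃ q s

  reflect-involutive : ∀ s → ¬ q s ≡ 0₃ → ∀ v → reflect s (reflect s v) ≡ v
  reflect-involutive s qs≢0 v = begin
    (v ⊕ (c · s)) ⊕ (c′ · s)         ≡⟨ ⊕-assoc v (c · s) (c′ · s) ⟩
    v ⊕ ((c · s) ⊕ (c′ · s))         ≡⟨ cong (v ⊕_) (·-distrib-+ c c′ s) ⟨
    v ⊕ ((c +₃ c′) · s)              ≡⟨ cong (λ t → v ⊕ (t · s)) c+c′≡0 ⟩
    v ⊕ (0₃ · s)                     ≡⟨ cong (v ⊕_) (0·-𝟎 s) ⟩
    v ⊕ 𝟎                            ≡⟨ ⊕-identityʳ v ⟩
    v                                ∎
    where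
    open ≡-Reasoning
    c = 2₃ *₃ B v s *₃ q s
    c′ = 2₃ *₃ B (v ⊕ (c · s)) s *₃ q s
    c+c′≡0 : c +₃ c′ ≡ 0₃
    c+c′≡0 = trans
      (cong (λ t → c +₃ 2₃ *₃ t *₃ q s)
        (trans (B-⊕ˡ v (c · s) s) (cong (B v s +₃_) (trans (B-·ˡ c s s) (cong (c *₃_) (B-self s))))))
      (decide (all? λ b → all? λ d → ¬? (d ≟ 0₃) →-dec
        (2₃ *₃ b *₃ d +₃ 2₃ *₃ (b +₃ 2₃ *₃ b *₃ d *₃ (2₃ *₃ d)) *₃ d ≟ 0₃)) (B v s) (q s) qs≢0)

  -- One of x ± y is nonsingular, and the reflection in it maps x to ∓ y.
  transport-perp : ∀ {m x y} → ¬ q x ≡ 0₃ → q x ≡ q y → TotallySingularInPerp m x → TotallySingularInPerp m y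
  transport-perp {x = x} {y} qx≢0 qx≡qy (ws , ws⊥x , indep , singular)
    -- q(x+y) + q(x-y) = 4 q(x) is nonzero, so at least one sign c works.
    with decide (all? λ η → all? λ β → ¬? (η ≟ 0₃) →-dec
           any? λ c → ¬? (c ≟ 0₃) ×-dec ¬? (η +₃ c *₃ c *₃ η +₃ c *₃ β ≟ 0₃)) (q x) (B x y) qx≢0
  ... | c , c≢0 , qs≢0′ =
    Vec.map (reflect s) ws ,
    toList⁺ (VecAll-map⁺ (VecAll.map (λ {w} → reflect-⊥ w) (toList⁻ ws⊥x))) ,
    (λ cs e → indep cs (begin
      lincomb cs ws                                    ≡⟨ reflect-involutive s qs≢0 _ ⟨
      reflect s (reflect s (lincomb cs ws))            ≡⟨ cong (reflect s) (reflect-lincomb s cs ws) ⟨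
      reflect s (lincomb cs (Vec.map (reflect s) ws))  ≡⟨ cong (reflect s) e ⟩
      reflect s 𝟎                                      ≡⟨ reflect-𝟎 s ⟩
      𝟎                                                ∎)) ,
    λ cs → trans (cong q (reflect-lincomb s cs ws)) (trans (q-reflect s _) (singular cs))
    where
    open ≡-Reasoning
    s = x ⊕ (c · y)
    η = q x
    β = B x y
    qs : q s ≡ η +₃ c *₃ c *₃ η +₃ c *₃ β
    qs = trans (q-⊕ x (c · y)) (cong₂ (λ t u → η +₃ t +₃ u)
           (trans (q-· c y) (cong (c *₃ c *₃_) (sym qx≡qy))) (B-·ʳ c x y))
    qs≢0 : ¬ q s ≡ 0₃
    qs≢0 e = qs≢0′ (trans (sym qs) e)
    Bws : ∀ w → B x w ≡ 0₃ → B w s ≡ c *₃ B y w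
    Bws w x⊥w = trans (B-⊕ʳ w x (c · y)) (trans
      (cong₂ _+₃_ (trans (B-sym w x) x⊥w) (trans (B-·ʳ c w y) (cong (c *₃_) (B-sym w y))))
      (decide (all? λ t → 0₃ +₃ t ≟ t) (c *₃ B y w)))
    Bys : B y s ≡ β +₃ c *₃ (2₃ *₃ η)
    Bys = trans (B-⊕ʳ y x (c · y)) (cong₂ _+₃_ (B-sym y x)
      (trans (B-·ʳ c y y) (cong (c *₃_) (trans (B-self y) (cong (2₃ *₃_) (sym qx≡qy))))))
    reflect-⊥ : ∀ w → B x w ≡ 0₃ → B y (reflect s w) ≡ 0₃
    reflect-⊥ w x⊥w = begin
      B y (w ⊕ ((2₃ *₃ B w s *₃ q s) · s))          ≡⟨ B-⊕ʳ y w _ ⟩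
      B y w +₃ B y ((2₃ *₃ B w s *₃ q s) · s)       ≡⟨ cong (B y w +₃_) (B-·ʳ (2₃ *₃ B w s *₃ q s) y s) ⟩
      B y w +₃ 2₃ *₃ B w s *₃ q s *₃ B y s
        ≡⟨ cong₂ (λ t u → B y w +₃ 2₃ *₃ t *₃ q s *₃ u) (Bws w x⊥w) Bys ⟩
      B y w +₃ 2₃ *₃ (c *₃ B y w) *₃ q s *₃ (β +₃ c *₃ (2₃ *₃ η))
        ≡⟨ cong (λ t → B y w +₃ 2₃ *₃ (c *₃ B y w) *₃ t *₃ (β +₃ c *₃ (2₃ *₃ η))) qs ⟩
      B y w +₃ 2₃ *₃ (c *₃ B y w) *₃ (η +₃ c *₃ c *₃ η +₃ c *₃ β) *₃ (β +₃ c *₃ (2₃ *₃ η))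
        -- Here β + 2cη = c q(s), so the added term is 2 c² q(s)² B(y,w) = -B(y,w).
        ≡⟨ decide (all? λ b → all? λ η → all? λ β → all? λ c → ¬? (c ≟ 0₃) →-dec (
             ¬? (η +₃ c *₃ c *₃ η +₃ c *₃ β ≟ 0₃) →-dec
             (b +₃ 2₃ *₃ (c *₃ b) *₃ (η +₃ c *₃ c *₃ η +₃ c *₃ β) *₃ (β +₃ c *₃ (2₃ *₃ η)) ≟ 0₃)))
             (B y w) η β c c≢0 qs≢0′ ⟩
      0₃ ∎

  module _ (nondeg : ∀ x → (∀ y → B x y ≡ 0₃) → x ≡ 𝟎) where

    private
      HyperbolicPair : Vec (Vect n) k → Set
      HyperbolicPair vs = ∃[ p ] ∃[ r ] (p ⟂ vs × r ⟂ vs × B p r ≡ 0₃ × q p ≡ 1₃ × q r ≡ 2₃)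

      -- If all three values of q agree, then q (x ⊕ y) is the other nonzero value.
      pair : ∀ {vs : Vec (Vect n) k} {x y z} → x ⟂ vs → y ⟂ (x ∷ vs) → z ⟂ (y ∷ x ∷ vs) →
             ∀ a b c → q x ≡ a → q y ≡ b → q z ≡ c → ¬ a ≡ 0₃ → ¬ b ≡ 0₃ → ¬ c ≡ 0₃ → HyperbolicPair vs
      pair {x = x} {y} {z} x⟂ (yx ∷ y⟂) (zy ∷ zx ∷ z⟂) = λ where
          zero a b qx qy qz a≢0 b≢0 c≢0 → contradiction refl a≢0
          a zero b qx qy qz a≢0 b≢0 c≢0 → contradiction refl b≢0
          a b zero qx qy qz a≢0 b≢0 c≢0 → contradiction refl c≢0
          (suc zero) (suc (suc zero)) _ qx qy qz _ _ _ → x , y , x⟂ , y⟂ , xy , qx , qy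
          (suc (suc zero)) (suc zero) _ qx qy qz _ _ _ → y , x , y⟂ , x⟂ , yx , qy , qx
          (suc zero) (suc zero) (suc (suc zero)) qx qy qz _ _ _ → x , z , x⟂ , z⟂ , xz , qx , qz
          (suc zero) (suc zero) (suc zero) qx qy qz _ _ _ →
            z , x ⊕ y , z⟂ , ⟂-⊕ x⟂ y⟂ , z⊥x+y , qz , q-x+y qx qy
          (suc (suc zero)) (suc (suc zero)) (suc zero) qx qy qz _ _ _ → z , x , z⟂ , x⟂ , zx , qz , qx
          (suc (suc zero)) (suc (suc zero)) (suc (suc zero)) qx qy qz _ _ _ →
            x ⊕ y , z , ⟂-⊕ x⟂ y⟂ , z⟂ , trans (B-sym _ z) z⊥x+y , q-x+y qx qy , qz
        where
        xy : B x y ≡ 0₃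
        xy = trans (B-sym x y) yx
        xz : B x z ≡ 0₃
        xz = trans (B-sym x z) zx
        z⊥x+y : B z (x ⊕ y) ≡ 0₃
        z⊥x+y = trans (B-⊕ʳ z x y) (cong₂ _+₃_ zx zy)
        q-x+y : ∀ {a b} → q x ≡ a → q y ≡ b → q (x ⊕ y) ≡ a +₃ b +₃ 0₃
        q-x+y {a} {b} qx qy = trans (q-⊕ x y) (trans (cong (q x +₃ q y +₃_) xy) (cong₂ (λ s t → s +₃ t +₃ 0₃) qx qy))

    -- The strict bound leaves room for three further vectors at each step, of which only a
    -- resulting pair is kept. Two could fail: orthogonal vectors of equal value span an anisotropic
    -- plane, which has no orthogonal pair of values 1 and -1.
    hyperbolicFrame : ∀ k → k * 2 < n → ∃[ vs ] Frame (hyp k) vs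
    hyperbolicFrame zero    _  = [] , []
    hyperbolicFrame (suc k) lt
      with vs , F ← hyperbolicFrame k (ℕ.<-trans (ℕ.m≤n+m _ 1) lt)
      with x , x⟂ , qx ← extend nondeg F (ℕ.<-trans (ℕ.m≤n+m _ 1) lt)
      with Fx ← frame qx refl x⟂ F
      with y , y⟂ , qy ← extend nondeg Fx (ℕ.<-trans ℕ.≤-refl lt)
      with z , z⟂ , qz ← extend nondeg (frame qy refl y⟂ Fx) lt
      with p , r , p⟂ , r⟂ , pr , qp , qr ← pair x⟂ y⟂ z⟂ _ _ _ refl refl refl qx qy qz
      = p ∷ r ∷ vs , frame (λ ()) qp (pr ∷ p⟂) (frame (λ ()) qr r⟂ F)

    hyperbolicFrame⁺ : ∀ k → k * 2 < n → ∃[ ε ] ∃[ vs ] Frame (ε ∷ hyp k) vs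
    hyperbolicFrame⁺ k lt
      with vs , F ← hyperbolicFrame k lt
      with z , z⟂ , qz ← extend nondeg F lt
      = q z , z ∷ vs , frame qz refl z⟂ F

  addPairs-⟂ : ∀ k {z} (vs : Vec (Vect n) (k * 2)) → z ⟂ vs → z ⟂ addPairs k vs
  addPairs-⟂ zero    []           []               = []
  addPairs-⟂ (suc k) {z} (p ∷ r ∷ vs) (zp ∷ zr ∷ z⟂) = trans (B-⊕ʳ z p r) (cong₂ _+₃_ zp zr) ∷ addPairs-⟂ k vs z⟂

  totallySingularInPerp : ∀ {m ε z vs} → Frame (ε ∷ hyp m) (z ∷ vs) → TotallySingularInPerp m z
  totallySingularInPerp {m} {z = z} {vs} (frame _ _ z⟂vs F) =
    addPairs m vs , toList⁺ (addPairs-⟂ m vs z⟂vs) ,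
    (λ cs e → dup≡𝟎 cs (lincomb-injective F (dup cs) 𝟎
      (trans (sym (lincomb-addPairs cs vs)) (trans e (sym (lincomb-𝟎 vs)))))) ,
    λ cs → trans (cong q (lincomb-addPairs cs vs)) (trans (q-lincomb F (dup cs)) (dform-dup cs))

-- Counting vectors of given norm

count : Vec F₃ k → F₃ → ℤ
count {k} ds c = sum (vects k) (χ λ y → dform ds y ≟ c)

-- The head coordinate is 0 once and ±1 twice, and contributes 0 or d accordingly.
count-∷ : ∀ d (ds : Vec F₃ k) c →
          count (d ∷ ds) c ≡ count ds c +ℤ count ds (c -₃ d) +ℤ count ds (c -₃ d)
count-∷ {k} d ds c = trans (sum-vects {k} (χ λ y → dform (d ∷ ds) y ≟ c)) (cong₂ _+ℤ_ (cong₂ _+ℤ_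
  (sum-cong (vects k) λ y →
    decide (all? λ d → all? λ e → all? λ c → eq? (d *₃ 0₃ *₃ 0₃ +₃ e) c e c) d (dform ds y) c)
  (sum-cong (vects k) λ y →
    decide (all? λ d → all? λ e → all? λ c → eq? (d *₃ 1₃ *₃ 1₃ +₃ e) c e (c -₃ d)) d (dform ds y) c))
  (sum-cong (vects k) λ y →
    decide (all? λ d → all? λ e → all? λ c → eq? (d *₃ 2₃ *₃ 2₃ +₃ e) c e (c -₃ d)) d (dform ds y) c))
  where
  eq? : ∀ (a b c d : F₃) → Dec ((if does (a ≟ b) then 1ℤ else 0ℤ) ≡ (if does (c ≟ d) then 1ℤ else 0ℤ))
  eq? a b c d = _ ℤ.≟ _

-- Each nonzero value is taken b = (9^k - 3^k)/3 times, and 0 is taken 3^k times more. The last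
-- equation, a count of all 9^k vectors, expresses this without division.
count-hyp : ∀ k → ∃[ b ] (count (hyp k) 0₃ ≡ b +ℤ + (3 ^ k) × count (hyp k) 1₃ ≡ b × count (hyp k) 2₃ ≡ b
                         × + 3 *ℤ b +ℤ + (3 ^ k) ≡ + (3 ^ k) *ℤ + (3 ^ k))
count-hyp zero = 0ℤ , refl , refl , refl , refl
count-hyp (suc k) with count-hyp k
... | b , c₀ , c₁ , c₂ , e =
    -- Adjoining -1 turns the counts for 0, 1, 2 into 3b + t, 3b, 3b + 2t; adjoining 1 then gives 9b
    -- + 2t for both nonzero values.
    + 9 *ℤ b +ℤ + 2 *ℤ t
  , trans (step 0₃) (trans (cong₂ _+ℤ_ (cong₂ _+ℤ_ (c 0₃ c₀ c₁ c₁) (c 2₃ c₂ c₀ c₀)) (c 2₃ c₂ c₀ c₀))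
      (trans (eq₀ b t) (cong (λ s → + 9 *ℤ b +ℤ + 2 *ℤ t +ℤ s) (sym 3t))))
  , trans (step 1₃) (trans (cong₂ _+ℤ_ (cong₂ _+ℤ_ (c 1₃ c₁ c₂ c₂) (c 0₃ c₀ c₁ c₁)) (c 0₃ c₀ c₁ c₁)) (eq₁ b t))
  , trans (step 2₃) (trans (cong₂ _+ℤ_ (cong₂ _+ℤ_ (c 2₃ c₂ c₀ c₀) (c 1₃ c₁ c₂ c₂)) (c 1₃ c₁ c₂ c₂)) (eq₂ b t))
  , trans (cong (+ 3 *ℤ (+ 9 *ℤ b +ℤ + 2 *ℤ t) +ℤ_) 3t)
      (trans (eq₃ b t) (trans (cong (+ 9 *ℤ_) e) (trans (eq₄ t) (sym (cong₂ _*ℤ_ 3t 3t)))))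
  where
  t = + (3 ^ k)
  3t : + (3 ^ suc k) ≡ + 3 *ℤ t
  3t = ℤ.pos-* 3 (3 ^ k)
  step : ∀ a → count (hyp (suc k)) a ≡
         count (2₃ ∷ hyp k) a +ℤ count (2₃ ∷ hyp k) (a -₃ 1₃) +ℤ count (2₃ ∷ hyp k) (a -₃ 1₃)
  step = count-∷ 1₃ (2₃ ∷ hyp k)
  c : ∀ a {x y z} → count (hyp k) a ≡ x → count (hyp k) (a -₃ 2₃) ≡ y → count (hyp k) (a -₃ 2₃) ≡ z →
      count (2₃ ∷ hyp k) a ≡ x +ℤ y +ℤ z
  c a p r s = trans (count-∷ 2₃ (hyp k) a) (cong₂ _+ℤ_ (cong₂ _+ℤ_ p r) s)
  eq₀ : ∀ b t → b +ℤ t +ℤ b +ℤ b +ℤ (b +ℤ (b +ℤ t) +ℤ (b +ℤ t)) +ℤ (b +ℤ (b +ℤ t) +ℤ (b +ℤ t))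
              ≡ + 9 *ℤ b +ℤ + 2 *ℤ t +ℤ + 3 *ℤ t
  eq₀ = solve-∀
  eq₁ : ∀ b t → b +ℤ b +ℤ b +ℤ (b +ℤ t +ℤ b +ℤ b) +ℤ (b +ℤ t +ℤ b +ℤ b) ≡ + 9 *ℤ b +ℤ + 2 *ℤ t
  eq₁ = solve-∀
  eq₂ : ∀ b t → b +ℤ (b +ℤ t) +ℤ (b +ℤ t) +ℤ (b +ℤ b +ℤ b) +ℤ (b +ℤ b +ℤ b) ≡ + 9 *ℤ b +ℤ + 2 *ℤ t
  eq₂ = solve-∀
  eq₃ : ∀ b t → + 3 *ℤ (+ 9 *ℤ b +ℤ + 2 *ℤ t) +ℤ + 3 *ℤ t ≡ + 9 *ℤ (+ 3 *ℤ b +ℤ t)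
  eq₃ = solve-∀
  eq₄ : ∀ t → + 9 *ℤ (t *ℤ t) ≡ + 3 *ℤ t *ℤ (+ 3 *ℤ t)
  eq₄ = solve-∀

count-hyp⁺ : ∀ k ε → ¬ ε ≡ 0₃ → count (ε ∷ hyp k) ε ≡ + (3 ^ k * (3 ^ k + 1))
count-hyp⁺ k ε ε≢0 with count-hyp k
... | b , c₀ , c₁ , c₂ , e = begin
  count (ε ∷ hyp k) ε                         ≡⟨ count-∷ ε (hyp k) ε ⟩
  count (hyp k) ε +ℤ count (hyp k) (ε -₃ ε) +ℤ count (hyp k) (ε -₃ ε)
    ≡⟨ cong₂ _+ℤ_ (cong₂ _+ℤ_ (cε ε ε≢0) cε-ε) cε-ε ⟩
  b +ℤ (b +ℤ t) +ℤ (b +ℤ t)                   ≡⟨ eq₁ b t ⟩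
  (+ 3 *ℤ b +ℤ t) +ℤ t                        ≡⟨ cong (_+ℤ t) e ⟩
  t *ℤ t +ℤ t                                 ≡⟨ eq₂ t ⟩
  t *ℤ (t +ℤ 1ℤ)                              ≡⟨ ℤ.pos-* (3 ^ k) (3 ^ k + 1) ⟨
  + (3 ^ k * (3 ^ k + 1))                     ∎
  where
  open ≡-Reasoning
  t = + (3 ^ k)
  cε : ∀ ε → ¬ ε ≡ 0₃ → count (hyp k) ε ≡ b
  cε zero             ε≢0 = contradiction refl ε≢0
  cε (suc zero)       _   = c₁
  cε (suc (suc zero)) _   = c₂
  cε-ε : count (hyp k) (ε -₃ ε) ≡ b +ℤ t
  cε-ε = trans (cong (count (hyp k)) (decide (all? λ a → a -₃ a ≟ 0₃) ε)) c₀
  eq₁ : ∀ b t → b +ℤ (b +ℤ t) +ℤ (b +ℤ t) ≡ (+ 3 *ℤ b +ℤ t) +ℤ t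
  eq₁ = solve-∀
  eq₂ : ∀ t → t *ℤ t +ℤ t ≡ t *ℤ (t +ℤ 1ℤ)
  eq₂ = solve-∀

-- From points to vectors, and bounds on level sets

Same : Vect n → Vect n → Set
Same x y = ∃[ c ] (¬ c ≡ 0₃ × y ≡ c · x)

-- Both nonzero vectors of each point, so that points are counted through vectors without halving.
±_ : List (Vect n) → List (Vect n)
± []      = []
± (x ∷ L) = x ∷ 2₃ · x ∷ ± L

length-± : (L : List (Vect n)) → length (± L) ≡ 2 * length L
length-± []      = refl
length-± (x ∷ L) = trans (cong (λ t → suc (suc t)) (length-± L)) (sym (ℕ.*-suc 2 (length L)))

All-± : {P : Vect n → Set} {L : List (Vect n)} → (∀ {x} → P x → P (2₃ · x)) → All P L → All P (± L)
All-± h []       = []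
All-± h (p ∷ ps) = p ∷ h p ∷ All-± h ps

∈-± : ∀ {x y} {L : List (Vect n)} → Same x y → x ∈ L → y ∈ ± L
∈-± {x = x} (zero , c≢0 , _)              _            = contradiction refl c≢0
∈-± {x = x} (suc zero , _ , refl)         (here refl)  = here (·-identity x)
∈-± {x = x} (suc (suc zero) , _ , refl)   (here refl)  = there (here refl)
∈-± same                                  (there x∈L)  = there (there (∈-± same x∈L))

module Count (S : QuadraticSpace n) where
  open Perp S public

  private variable
    ds : Vec F₃ k
    vs : Vec (Vect n) k

  q-2· : ∀ x → q (2₃ · x) ≡ q x
  q-2· x = trans (q-· 2₃ x) (*-identityˡ (q x))

  -- Independence of the frame sends coordinates to distinct vectors, hence a lower bound on the
  -- level set; the reverse bound `≤level` rests on spanning.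
  level≤ : Frame {k} ds vs → ∀ c {M} → (∀ {x} → q x ≡ c → x ∈ M) → count ds c ≤ℤ + length M
  level≤ {k} {ds} {vs} F c {M} ∈M = subst (_≤ℤ + length M) (length-filter≡sum P? (vects k))
    (+≤+ (subst (_≤ length M) (length-map φ L)
      (pigeonhole (Unique.map⁺ (λ {x y} → lincomb-injective F x y) (Unique.filter⁺ P? (vects-unique k))) φL⊆M)))
    where
    φ : Vect k → Vect n
    φ y = lincomb y vs
    P? : ∀ y → Dec (dform ds y ≡ c)
    P? y = dform ds y ≟ c
    L = filter P? (vects k)
    φL⊆M : List.map φ L ⊆ M
    φL⊆M x∈ with y , y∈L , refl ← ∈-map⁻ φ x∈ =
      ∈M (trans (q-lincomb F y) (proj₂ (∈-filter⁻ P? {xs = vects k} y∈L)))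

  ≤level : Frame {k} ds vs → (∀ x → ∃[ cs ] x ≡ lincomb cs vs) →
           ∀ c {M} → Unique M → All (λ x → q x ≡ c) M → + length M ≤ℤ count ds c
  ≤level {k} {ds} {vs} F span c {M} M! qM = subst (+ length M ≤ℤ_) (length-filter≡sum P? (vects k))
    (+≤+ (subst (length M ≤_) (length-map φ L) (pigeonhole M! M⊆φL)))
    where
    φ : Vect k → Vect n
    φ y = lincomb y vs
    P? : ∀ y → Dec (dform ds y ≡ c)
    P? y = dform ds y ≟ c
    L = filter P? (vects k)
    M⊆φL : M ⊆ List.map φ L
    M⊆φL {x} x∈M with y , refl ← span x =
      ∈-map⁺ φ (∈-filter⁺ P? (∈-vects y) (trans (sym (q-lincomb F y)) (All.lookup qM x∈M)))

  2·-fixpointFree : ∀ {x} → ¬ q x ≡ 0₃ → ¬ x ≡ 2₃ · x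
  2·-fixpointFree {x} qx≢0 e = qx≢0 (decide (all? λ a → (2₃ *₃ a ≟ 2₃ *₃ (2₃ *₃ a)) →-dec (a ≟ 0₃)) (q x)
    (trans (sym (B-self x)) (trans (cong (B x) e) (trans (B-·ʳ 2₃ x x) (cong (2₃ *₃_) (B-self x))))))

  ±-unique : ∀ {L} → All (λ x → ¬ q x ≡ 0₃) L → AllPairs (λ x y → ¬ Same x y) L → Unique (± L)
  ±-unique [] [] = []
  ±-unique {x ∷ L} (qx≢0 ∷ qL) (x≁L ∷ L≁) =
    (2·-fixpointFree qx≢0 ∷ All.map (λ x≁y e → x≁y (1₃ , (λ ()) , trans (sym e) (sym (·-identity x)))) x≁±L)
    ∷ All.map (λ x≁y e → x≁y (2₃ , (λ ()) , sym e)) x≁±L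
    ∷ ±-unique qL L≁
    where
    x≁±L : All (λ y → ¬ Same x y) (± L)
    x≁±L = All-± (λ {y} x≁y (c , c≢0 , e) → x≁y
      ( 2₃ *₃ c
      , decide (all? λ c → ¬? (c ≟ 0₃) →-dec ¬? (2₃ *₃ c ≟ 0₃)) c c≢0
      , trans (sym (·-identity y)) (trans (·-assoc 2₃ 2₃ y) (trans (cong (2₃ ·_) e) (sym (·-assoc 2₃ c x)))))) x≁L

-- The Delsarte-type bound on cliques

-- g t = ζᵗ + ζ⁻ᵗ for a primitive cube root of unity ζ.
g : F₃ → ℤ
g zero    = + 2
g (suc _) = - 1ℤ

g-nonzero : ∀ {a} → ¬ a ≡ 0₃ → g a ≡ - 1ℤ
g-nonzero {zero}  a≢0 = contradiction refl a≢0
g-nonzero {suc _} _   = refl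

-- Translations by u and 2u permute the summands, so three times the sum collects `f` over the
-- cosets of ⟨u⟩.
sum-average : ∀ (u : Vect n) (f : Vect n → ℤ) c →
              (∀ v → f v +ℤ f (u ⊕ v) +ℤ f ((2₃ · u) ⊕ v) ≡ c) →
              + 3 *ℤ sum (vects n) f ≡ + (3 ^ n) *ℤ c
sum-average {n} u f c avg = begin
  + 3 *ℤ Σf                        ≡⟨ triple Σf ⟩
  Σf +ℤ Σf +ℤ Σf
    ≡⟨ cong₂ (λ s t → Σf +ℤ s +ℤ t) (sum-translate u f) (sum-translate (2₃ · u) f) ⟨
  Σf +ℤ sum V (λ v → f (u ⊕ v)) +ℤ sum V (λ v → f ((2₃ · u) ⊕ v))
    ≡⟨ cong (_+ℤ sum V (λ v → f ((2₃ · u) ⊕ v))) (sum-+ V f (λ v → f (u ⊕ v))) ⟨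
  sum V (λ v → f v +ℤ f (u ⊕ v)) +ℤ sum V (λ v → f ((2₃ · u) ⊕ v))
    ≡⟨ sum-+ V (λ v → f v +ℤ f (u ⊕ v)) (λ v → f ((2₃ · u) ⊕ v)) ⟨
  sum V (λ v → f v +ℤ f (u ⊕ v) +ℤ f ((2₃ · u) ⊕ v))    ≡⟨ sum-cong V avg ⟩
  sum V (λ _ → c)                  ≡⟨ sum-const V c ⟩
  + length V *ℤ c                  ≡⟨ cong (λ l → + l *ℤ c) (length-vects n) ⟩
  + (3 ^ n) *ℤ c                   ∎
  where
  open ≡-Reasoning
  V = vects n
  Σf = sum V f
  triple : ∀ s → + 3 *ℤ s ≡ s +ℤ s +ℤ s
  triple = solve-∀

square-nonneg : ∀ i → 0ℤ ≤ℤ i *ℤ i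
square-nonneg (+ n)    = subst (0ℤ ≤ℤ_) (ℤ.pos-* n n) (+≤+ z≤n)
square-nonneg -[1+ n ] = +≤+ z≤n

allPairs-lookup : {A : Set} {R : A → A → Set} {L : List A} → (∀ {x y} → R x y → R y x) →
                  All (λ x → R x x) L → AllPairs R L → All (λ x → All (R x) L) L
allPairs-lookup s []       []       = []
allPairs-lookup s (r ∷ rs) (p ∷ ps) =
  (r ∷ p) ∷ All.zipWith (λ (xy , yL) → s xy ∷ yL) (p , allPairs-lookup s rs ps)

sum-const-All : {A : Set} {L : List A} {f : A → ℤ} {c : ℤ} → All (λ x → f x ≡ c) L → sum L f ≡ + length L *ℤ c
sum-const-All {L = []}    {c = c} []       = refl
sum-const-All {L = x ∷ L} {c = c} (e ∷ es) = trans (cong₂ _+ℤ_ e (sum-const-All es)) (sym (ℤ.suc-* (+ length L) c))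

module CliqueBound (S : QuadraticSpace n) where
  open Count S public

  module _ (nondeg : ∀ x → (∀ y → B x y ≡ 0₃) → x ≡ 𝟎) where

    -- The part y′ of `y` orthogonal to `x` is nonzero, as `y` is not a multiple of `x`. A vector
    -- not orthogonal to y′, projected to x^⊥, serves as `u`.
    separate : ∀ {x y} → ¬ q x ≡ 0₃ → ¬ q y ≡ 0₃ → ¬ Same x y → ∃[ u ] (B x u ≡ 0₃ × ¬ B y u ≡ 0₃)
    separate {x} {y} qx≢0 qy≢0 x≁y
      with Fx ← frame qx≢0 refl [] []
      with c ∷ [] , y′⟂ ← orthogonalize Fx y
      with search-Vect n (λ z → ¬? (B (y ⊕ lincomb (c ∷ []) (x ∷ [])) z ≟ 0₃))
    ... | no ¬found = contradiction
      ((2₃ *₃ c) , (λ 2c≡0 → qy≢0 (trans (cong q (trans y≡ (cong (_· x) 2c≡0))) (q-· 0₃ x))) , y≡) x≁y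
      where
      y≡ : y ≡ (2₃ *₃ c) · x
      y≡ = trans (⊕≡𝟎⇒ y _ (nondeg _ λ z → decidable-stable (B _ z ≟ 0₃) λ ≢0 → ¬found (z , ≢0)))
        (trans (cong (2₃ ·_) (⊕-identityʳ (c · x))) (sym (·-assoc 2₃ c x)))
    ... | yes (z , y′z≢0) with ds , u⟂ ← orthogonalize Fx z =
      u , trans (B-sym x u) (VecAll.head u⟂) , λ yu≡0 → y′z≢0 (begin
        B y′ z                  ≡⟨ decide (all? λ b → b ≟ b +₃ 0₃) (B y′ z) ⟩
        B y′ z +₃ 0₃            ≡⟨ cong (B y′ z +₃_) (⟂-lincomb y′⟂ ds) ⟨
        B y′ z +₃ B y′ l        ≡⟨ B-⊕ʳ y′ z l ⟨
        B y′ u                  ≡⟨ B-⊕ˡ y l′ u ⟩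
        B y u +₃ B l′ u         ≡⟨ cong₂ _+₃_ yu≡0 (trans (B-sym l′ u) (⟂-lincomb u⟂ (c ∷ []))) ⟩
        0₃                      ∎)
      where
      open ≡-Reasoning
      l = lincomb ds (x ∷ [])
      l′ = lincomb (c ∷ []) (x ∷ [])
      u = z ⊕ l
      y′ = y ⊕ l′

    Σ-gg : Vect n → Vect n → ℤ
    Σ-gg x y = sum (vects n) λ v → g (B x v) *ℤ g (B y v)

    -- Moving along `u` fixes B(x,v) and runs B(y,v) through all of F₃, over which `g` sums to 2 - 1
    -- - 1 = 0.
    Σ-gg-distinct : ∀ {x y} → ¬ q x ≡ 0₃ → ¬ q y ≡ 0₃ → ¬ Same x y → Σ-gg x y ≡ 0ℤ
    Σ-gg-distinct {x} {y} qx≢0 qy≢0 x≁y with u , xu , yu ← separate qx≢0 qy≢0 x≁y =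
      ℤ.*-cancelˡ-≡ (+ 3) _ _ (trans (sum-average u _ 0ℤ λ v → trans
        (cong₂ (λ s t → g (B x v) *ℤ g (B y v) +ℤ s +ℤ t)
          (cong₂ (λ s t → g s *ℤ g t) (trans (B-⊕ʳ x u v) (cong (_+₃ B x v) xu)) (B-⊕ʳ y u v))
          (cong₂ (λ s t → g s *ℤ g t)
            (trans (B-⊕ʳ x (2₃ · u) v) (cong (_+₃ B x v) (trans (B-·ʳ 2₃ x u) (cong (2₃ *₃_) xu))))
            (trans (B-⊕ʳ y (2₃ · u) v) (cong (_+₃ B y v) (B-·ʳ 2₃ y u)))))
        (decide (all? λ a → all? λ b → all? λ t → ¬? (t ≟ 0₃) →-dec
          (g a *ℤ g b +ℤ g (0₃ +₃ a) *ℤ g (t +₃ b) +ℤ g (0₃ +₃ a) *ℤ g (2₃ *₃ t +₃ b) ℤ.≟ 0ℤ))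
          (B x v) (B y v) (B y u) yu)) (ℤ.*-zeroʳ (+ (3 ^ n))))

    -- Moving along `x` runs B(x,v) through all of F₃, where g² sums to 4 + 1 + 1 = 6, an average of
    -- 2.
    Σ-gg-self : ∀ {x} → ¬ q x ≡ 0₃ → Σ-gg x x ≡ + 2 *ℤ + (3 ^ n)
    Σ-gg-self {x} qx≢0 =
      ℤ.*-cancelˡ-≡ (+ 3) _ _ (trans (sum-average x _ (+ 6) λ v → trans
        (cong₂ (λ s t → g (B x v) *ℤ g (B x v) +ℤ g s *ℤ g s +ℤ g t *ℤ g t)
          (trans (B-⊕ʳ x x v) (cong (_+₃ B x v) (B-self x)))
          (trans (B-⊕ʳ x (2₃ · x) v) (cong (_+₃ B x v) (trans (B-·ʳ 2₃ x x) (cong (2₃ *₃_) (B-self x))))))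
        (decide (all? λ b → all? λ t → ¬? (t ≟ 0₃) →-dec
          (g b *ℤ g b +ℤ g (2₃ *₃ t +₃ b) *ℤ g (2₃ *₃ t +₃ b)
            +ℤ g (2₃ *₃ (2₃ *₃ t) +₃ b) *ℤ g (2₃ *₃ (2₃ *₃ t) +₃ b) ℤ.≟ + 6))
          (B x v) (q x) qx≢0)) (eq (+ (3 ^ n))))
      where
      eq : ∀ t → t *ℤ + 6 ≡ + 3 *ℤ (+ 2 *ℤ t)
      eq = solve-∀

    Σg : List (Vect n) → Vect n → ℤ
    Σg L v = sum L λ c → g (B c v)

    Σg-cross : ∀ {x} L → All (λ y → Σ-gg x y ≡ 0ℤ) L → sum (vects n) (λ v → g (B x v) *ℤ Σg L v) ≡ 0ℤ
    Σg-cross {x} []      []       = trans (sum-cong (vects n) λ v → ℤ.*-zeroʳ (g (B x v)))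
      (trans (sum-const (vects n) 0ℤ) (ℤ.*-zeroʳ (+ length (vects n))))
    Σg-cross {x} (y ∷ L) (e ∷ es) = trans (sum-cong (vects n) λ v → ℤ.*-distribˡ-+ (g (B x v)) (g (B y v)) (Σg L v))
      (trans (sum-+ (vects n) (λ v → g (B x v) *ℤ g (B y v)) (λ v → g (B x v) *ℤ Σg L v))
        (cong₂ _+ℤ_ e (Σg-cross L es)))

    -- Pythagoras for pairwise orthogonal functions of squared norm 2 · 3^n.
    Σg-square : ∀ {L} → All (λ x → ¬ q x ≡ 0₃) L → AllPairs (λ x y → ¬ Same x y) L →
                sum (vects n) (λ v → Σg L v *ℤ Σg L v) ≡ + length L *ℤ (+ 2 *ℤ + (3 ^ n))
    Σg-square [] [] = trans (sum-const (vects n) 0ℤ) (ℤ.*-zeroʳ (+ length (vects n)))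
    Σg-square {x ∷ L} (qx≢0 ∷ qL) (x≁L ∷ L≁) = begin
      sum V (λ v → Σg (x ∷ L) v *ℤ Σg (x ∷ L) v)
        ≡⟨ sum-cong V (λ v → expand (g (B x v)) (Σg L v)) ⟩
      sum V (λ v → gx v *ℤ gx v +ℤ + 2 *ℤ (gx v *ℤ Σg L v) +ℤ Σg L v *ℤ Σg L v)
        ≡⟨ sum-+ V (λ v → gx v *ℤ gx v +ℤ + 2 *ℤ (gx v *ℤ Σg L v)) (λ v → Σg L v *ℤ Σg L v) ⟩
      sum V (λ v → gx v *ℤ gx v +ℤ + 2 *ℤ (gx v *ℤ Σg L v)) +ℤ sum V (λ v → Σg L v *ℤ Σg L v)
        ≡⟨ cong₂ _+ℤ_ (sum-+ V (λ v → gx v *ℤ gx v) (λ v → + 2 *ℤ (gx v *ℤ Σg L v))) (Σg-square qL L≁) ⟩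
      Σ-gg x x +ℤ sum V (λ v → + 2 *ℤ (gx v *ℤ Σg L v)) +ℤ + length L *ℤ c
        ≡⟨ cong₂ (λ s t → s +ℤ t +ℤ + length L *ℤ c) (Σ-gg-self qx≢0)
             (trans (sum-* V (+ 2) (λ v → gx v *ℤ Σg L v)) (cong (+ 2 *ℤ_) (Σg-cross L
               (All.zipWith (λ (qy≢0 , x≁y) → Σ-gg-distinct qx≢0 qy≢0 x≁y) (qL , x≁L))))) ⟩
      c +ℤ 0ℤ +ℤ + length L *ℤ c                     ≡⟨ cong (_+ℤ + length L *ℤ c) (ℤ.+-identityʳ c) ⟩
      c +ℤ + length L *ℤ c                           ≡⟨ ℤ.suc-* (+ length L) c ⟨
      + length (x ∷ L) *ℤ c                          ∎
      where
      open ≡-Reasoning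
      V = vects n
      c = + 2 *ℤ + (3 ^ n)
      gx : Vect n → ℤ
      gx v = g (B x v)
      expand : ∀ a b → (a +ℤ b) *ℤ (a +ℤ b) ≡ a *ℤ a +ℤ + 2 *ℤ (a *ℤ b) +ℤ b *ℤ b
      expand = solve-∀

    clique-bound : ∀ {L} → All (λ x → ¬ q x ≡ 0₃) L → AllPairs (λ x y → ¬ Same x y) L →
                   AllPairs (λ x y → ¬ B x y ≡ 0₃) L → length L * length L ≤ 3 ^ n
    clique-bound {[]}    _  _  _  = z≤n
    -- The factor 2|L| common to both sides is cancelled, hence the separate empty case.
    clique-bound {L@(_ ∷ _)} qL L≁ BL = ℕ.*-cancelˡ-≤ (2 * length L) (ℤ.drop‿+≤+ (begin
      + (2 * l * (l * l))                                 ≡⟨ ℤ.pos-* (2 * l) (l * l) ⟩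
      + (2 * l) *ℤ + (l * l)                              ≡⟨ cong₂ (λ s t → + s *ℤ t) (sym (length-± L)) (ℤ.pos-* l l) ⟩
      + length (± L) *ℤ (+ l *ℤ + l)                      ≡⟨ sum-const-All Σg²-± ⟨
      sum (± L) (λ v → Σg L v *ℤ Σg L v)
        ≤⟨ sum-mono-⊆ (λ v → square-nonneg (Σg L v)) (±-unique qL L≁) (λ {x} _ → ∈-vects x) ⟩
      sum (vects n) (λ v → Σg L v *ℤ Σg L v)              ≡⟨ Σg-square qL L≁ ⟩
      + l *ℤ (+ 2 *ℤ + (3 ^ n))                           ≡⟨ eq (+ l) (+ (3 ^ n)) ⟩
      + 2 *ℤ + l *ℤ + (3 ^ n)                             ≡⟨ cong (_*ℤ + (3 ^ n)) (ℤ.pos-* 2 l) ⟨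
      + (2 * l) *ℤ + (3 ^ n)                              ≡⟨ ℤ.pos-* (2 * l) (3 ^ n) ⟨
      + (2 * l * 3 ^ n)                                   ∎))
      where
      open ℤ.≤-Reasoning
      l = length L
      eq : ∀ a t → a *ℤ (+ 2 *ℤ t) ≡ + 2 *ℤ a *ℤ t
      eq = solve-∀
      eq′ : ∀ a → a *ℤ (- 1ℤ) *ℤ (a *ℤ (- 1ℤ)) ≡ a *ℤ a
      eq′ = solve-∀
      -- This covers c = ±v as well, since B(v,v) = 2 q(v) is nonzero: no term of `Σg L v` takes the
      -- value 2.
      nonadjacent : All (λ v → All (λ c → ¬ B c v ≡ 0₃) L) (± L)
      nonadjacent = All-±
        (λ {v} → All.map λ {c} cv≢0 → λ e → decide (all? λ b → ¬? (b ≟ 0₃) →-dec ¬? (2₃ *₃ b ≟ 0₃)) (B c v) cv≢0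
          (trans (sym (B-·ʳ 2₃ c v)) e))
        (All.map (All.map λ {c} vc≢0 e → vc≢0 (trans (B-sym _ c) e))
          (allPairs-lookup (λ {x} {y} xy≢0 e → xy≢0 (trans (B-sym x y) e))
            (All.map (λ {x} qx≢0 e → decide (all? λ a → ¬? (a ≟ 0₃) →-dec ¬? (2₃ *₃ a ≟ 0₃)) (q x) qx≢0
              (trans (sym (B-self x)) e)) qL) BL))
      Σg²-± : All (λ v → Σg L v *ℤ Σg L v ≡ + l *ℤ + l) (± L)
      Σg²-± = All.map (λ {v} cv≢0 → trans
        (cong (λ t → t *ℤ t) (sum-const-All (All.map g-nonzero cv≢0))) (eq′ (+ l))) nonadjacent

-- Maximal cliques, cocliques and the order

Same-sym : ∀ {x y : Vect n} → Same x y → Same y x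
Same-sym {x = x} (c , c≢0 , refl) = c , c≢0 , sym (begin
  c · (c · x)     ≡⟨ ·-assoc c c x ⟨
  (c *₃ c) · x    ≡⟨ cong (_· x) (decide (all? λ c → ¬? (c ≟ 0₃) →-dec (c *₃ c ≟ 1₃)) c c≢0) ⟩
  1₃ · x          ≡⟨ ·-identity x ⟩
  x               ∎)
  where open ≡-Reasoning

Same? : ∀ (x y : Vect n) → Dec (Same x y)
Same? x y = any? λ c → ¬? (c ≟ 0₃) ×-dec ≡-dec _≟_ y (c · x)

distinct⇒unique : {L : List (Vect n)} → AllPairs (λ x y → ¬ Same x y) L → Unique L
distinct⇒unique = AllPairs.map λ {x} x≁y x≡y → x≁y (1₃ , (λ ()) , trans (sym x≡y) (sym (·-identity x)))

-- Lists with `P` have no repetitions, hence length at most 3^n; those of a fixed length are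
-- searched as vectors over a finite set.
longest : {P : List (Vect n) → Set} → (∀ L → Dec (P L)) → P [] → (∀ {L} → P L → Unique L) →
          ∃[ j ] ((∃[ L ] (P L × length L ≡ j)) × (∀ L → P L → length L ≤ j))
longest {n} {P} P? P[] P⇒unique with maximum
  (λ j → map′ (λ (vs , p) → toList vs , p , length-toList vs)
              (λ { (L , p , refl) → Vec.fromList L , subst P (sym (toList∘fromList L)) p })
              (search-Vec (search-Vect n) j λ vs → P? (toList vs)))
  (length (vects n))
  (λ { j (L , p , refl) → pigeonhole (P⇒unique p) λ {x} _ → ∈-vects x })
  (0 , [] , P[] , refl)
... | j , pj , max = j , pj , λ L p → max (length L) (L , p , refl)

-- Sharp at m = 3, where both sides are 28. The factor 4 replaces 2√3, that is, ω ≤ √3 t is weakened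
-- to ω < 2t.
dimension≤power : ∀ j → 4 * suc ((3 + j) * 2) ≤ 3 ^ (3 + j) + 1
dimension≤power zero    = ℕ.≤-refl
dimension≤power (suc j) = begin
  4 * suc (suc m * 2)          ≡⟨ eq₁ m ⟩
  4 * suc (m * 2) + 8          ≤⟨ ℕ.+-mono-≤ (dimension≤power j) 8≤ ⟩
  3 ^ m + 1 + 2 * 3 ^ m        ≡⟨ eq₂ (3 ^ m) ⟩
  3 ^ suc m + 1                ∎
  where
  open ℕ.≤-Reasoning
  m = 3 + j
  8≤ : 8 ≤ 2 * 3 ^ m
  8≤ = ℕ.*-monoʳ-≤ 2 (ℕ.≤-trans (decide (4 ℕ.≤? 27)) (ℕ.^-monoʳ-≤ 3 {3} {m} (ℕ.m≤m+n 3 j)))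
  eq₁ : ∀ m → 4 * suc (suc m * 2) ≡ 4 * suc (m * 2) + 8
  eq₁ = ℕ-Solver.solve-∀
  eq₂ : ∀ t → t + 1 + 2 * t ≡ 3 * t + 1
  eq₂ = ℕ-Solver.solve-∀

-- From 2 t (t + 1) ≤ 4 ω α ≤ ω (t + 1) one gets 2 t ≤ ω, so 4 t² ≤ ω² ≤ 3 t².
bounds-contradictory : ∀ {t ω α N} → 1 ≤ t → t * (t + 1) ≤ 2 * N → N ≤ ω * α → ω * ω ≤ 3 * (t * t) → 4 * α ≤ t + 1 → ⊥
bounds-contradictory {t} {ω} {α} {N} 1≤t order N≤ωα ω²≤ α≤ = ℕ.<-irrefl refl (begin-strict
  3 * (t * t)           <⟨ ℕ.*-monoˡ-< (t * t) {{>-nonZero (ℕ.*-mono-≤ 1≤t 1≤t)}} (ℕ.n<1+n 3) ⟩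
  4 * (t * t)           ≡⟨ eq₁ t ⟩
  2 * t * (2 * t)       ≤⟨ ℕ.*-mono-≤ 2t≤ω 2t≤ω ⟩
  ω * ω                 ≤⟨ ω²≤ ⟩
  3 * (t * t)           ∎)
  where
  open ℕ.≤-Reasoning
  eq₁ : ∀ t → 4 * (t * t) ≡ 2 * t * (2 * t)
  eq₁ = ℕ-Solver.solve-∀
  eq₂ : ∀ ω α → 2 * (2 * (ω * α)) ≡ ω * (4 * α)
  eq₂ = ℕ-Solver.solve-∀
  2t≤ω : 2 * t ≤ ω
  2t≤ω = ℕ.*-cancelʳ-≤ (2 * t) ω (t + 1) {{>-nonZero (ℕ.m≤n+m 1 t)}} (begin
    2 * t * (t + 1)       ≡⟨ ℕ.*-assoc 2 t (t + 1) ⟩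
    2 * (t * (t + 1))     ≤⟨ ℕ.*-monoʳ-≤ 2 (ℕ.≤-trans order (ℕ.*-monoʳ-≤ 2 N≤ωα)) ⟩
    2 * (2 * (ω * α))     ≡⟨ eq₂ ω α ⟩
    ω * (4 * α)           ≤⟨ ℕ.*-monoʳ-≤ ω α≤ ⟩
    ω * (t + 1)           ∎)

-- The graph over an abstract quadratic space, and the case m ≥ 3

module PointGraph (S : QuadraticSpace n) (nondeg : ∀ x → (∀ y → QuadraticSpace.B S x y ≡ 0₃) → x ≡ 𝟎) where
  open CliqueBound S public

  -- Unfolds to `NOPlus m Q` for `quadraticSpace Q`, but keeps `m` apart from the dimension `n`,
  -- whose relation to `m` is supplied where it is used.
  points : ℕ → Graph
  points m = record
    { Carrier    = Vect n
    ; IsVertex   = λ x → ¬ x ≡ 𝟎 × ¬ q x ≡ 0₃ × NondegenerateOnPerp x × TotallySingularInPerp m x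
    ; SameVertex = Same
    ; Adj        = λ x y → ¬ B x y ≡ 0₃
    }

  nonsingular : ∀ {m L} → All (Graph.IsVertex (points m)) L → All (λ x → ¬ q x ≡ 0₃) L
  nonsingular = All.map (proj₁ ∘ proj₂)

  -- Nonadjacency is the double negation of orthogonality, removed by decidability of equality in
  -- F₃.
  orthogonal⇒frame : ∀ L → All (λ x → ¬ q x ≡ 0₃) L → AllPairs (λ x y → ¬ ¬ B x y ≡ 0₃) L →
                     ∃[ ds ] Frame ds (Vec.fromList L)
  orthogonal⇒frame []      []           []         = [] , []
  orthogonal⇒frame (x ∷ L) (qx≢0 ∷ qL) (x⊥L ∷ L⊥) with ds , F ← orthogonal⇒frame L qL L⊥ =
    q x ∷ ds , frame qx≢0 refl (toList⁻ (subst (All (λ y → B x y ≡ 0₃)) (sym (toList∘fromList L))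
      (All.map (decidable-stable (_ ≟ 0₃)) x⊥L))) F

  coclique-bound : ∀ {m L} → IsCoclique (points m) L → length L ≤ n
  coclique-bound {L = L} ((vL , _) , L⊥) = frame-length≤ (proj₂ (orthogonal⇒frame L (nonsingular vL) L⊥))

  level⇒vertex : ∀ {m ε basis} → Frame (ε ∷ hyp m) basis → ∀ {x} → q x ≡ ε → Graph.IsVertex (points m) x
  level⇒vertex F@(frame ε≢0 qz≡ε _ _) {x} qx≡ε =
    (λ { refl → qx≢0 q-𝟎 }) , qx≢0 , nondegenerateOnPerp nondeg x qx≢0 ,
    transport-perp (λ qz≡0 → ε≢0 (trans (sym qz≡ε) qz≡0)) (trans qz≡ε (sym qx≡ε)) (totallySingularInPerp F)
    where
    qx≢0 : ¬ q x ≡ 0₃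
    qx≢0 e = ε≢0 (trans (sym qx≡ε) e)

  -- Completeness of the vertex list puts every vector of value ε into `± L`, which has length 2N.
  order-lower-bound : ∀ {m ε basis} → Frame (ε ∷ hyp m) basis →
                      ∀ {N} → HasOrder (points m) N → 3 ^ m * (3 ^ m + 1) ≤ 2 * N
  order-lower-bound {m} {ε} F@(frame ε≢0 _ _ _) (L , _ , refl , complete) = ℤ.drop‿+≤+ (subst₂ _≤ℤ_
    (count-hyp⁺ m ε ε≢0) (cong +_ (length-± L))
    (level≤ F ε λ {x} qx → let l , l∈L , x~l = find (complete x (level⇒vertex F qx)) in ∈-± (Same-sym x~l) l∈L))

  order-upper-bound : ∀ {m ε vs} → Frame (ε ∷ hyp m) vs → ¬ ε ≡ 0₃ → n ≤ suc (m * 2) →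
                      (∀ {x} → Graph.IsVertex (points m) x → q x ≡ ε) →
                      ∀ {N} → HasOrder (points m) N → 2 * N ≤ 3 ^ m * (3 ^ m + 1)
  order-upper-bound {m} {ε} F ε≢0 n≤ point⇒level (L , (vL , L≁) , refl , _) = subst (_≤ _) (length-± L)
    (ℤ.drop‿+≤+ (subst (+ length (± L) ≤ℤ_) (count-hyp⁺ m ε ε≢0)
      (≤level F (spanning nondeg F n≤) ε (±-unique (nonsingular {m} vL) L≁)
        (All-± (λ {x} qx → trans (q-2· x) qx) (All.map point⇒level vL)))))

  separating : ∀ j → let m = 3 + j in n ≡ suc (m * 2) → ¬ NonSeparating (points m)
  separating j n≡ (ω , α , N , ((C , ((vC , C≁) , CB) , refl) , _) , ((D , D-coclique , refl) , _) , order , N≤ωα) =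
    let ε , basis , F = hyperbolicFrame⁺ nondeg m (ℕ.≤-reflexive (sym n≡)) in
    bounds-contradictory {3 ^ m} {length C} {length D} (ℕ.m^n>0 3 m) (order-lower-bound F order) N≤ωα
      (subst (length C * length C ≤_) (trans (cong (3 ^_) n≡) (3^odd m)) (clique-bound nondeg (nonsingular vC) C≁ CB))
      (ℕ.≤-trans (ℕ.*-monoʳ-≤ 4 (subst (length D ≤_) n≡ (coclique-bound {m} D-coclique))) (dimension≤power j))
    where
    m = 3 + j
    3^odd : ∀ m → 3 ^ suc (m * 2) ≡ 3 * (3 ^ m * 3 ^ m)
    3^odd m = cong (3 *_) (trans
      (cong (3 ^_) (trans (ℕ.*-comm m 2) (cong (λ t → m + t) (ℕ.+-identityʳ m)))) (ℕ.^-distribˡ-+-* 3 m m))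

  module Extremal {m} (point? : ∀ x → Dec (Graph.IsVertex (points m) x)) where

    vertexList? : ∀ L → Dec (VertexList (points m) L)
    vertexList? L = All.all? point? L ×-dec AllPairs.allPairs? (λ x y → ¬? (Same? x y)) L

    cliqueNumber : ∃[ ω ] IsCliqueNumber (points m) ω
    cliqueNumber = longest (λ L → vertexList? L ×-dec AllPairs.allPairs? (λ x y → ¬? (B x y ≟ 0₃)) L)
      (([] , []) , []) (distinct⇒unique ∘ proj₂ ∘ proj₁)

    cocliqueNumber : ∃[ α ] IsCocliqueNumber (points m) α
    cocliqueNumber = longest (λ L → vertexList? L ×-dec AllPairs.allPairs? (λ x y → ¬? (¬? (B x y ≟ 0₃))) L)
      (([] , []) , []) (distinct⇒unique ∘ proj₂ ∘ proj₁)

    -- A longest list of distinct vertices is complete, because a missed vertex could be prepended.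
    order : ∃[ N ] HasOrder (points m) N
    order =
      let N , (L , (vL , L≁) , length≡) , max = longest vertexList? ([] , []) (distinct⇒unique ∘ proj₂)
      in N , L , (vL , L≁) , length≡ , λ x x-vertex →
        decidable-stable (Any.any? (Same? x) L) λ x∉L →
          ℕ.<⇒≱ (ℕ.n<1+n N) (subst (λ l → suc l ≤ N) length≡
            (max (x ∷ L) (x-vertex ∷ vL , All.¬Any⇒All¬ L x∉L ∷ L≁)))

-- The five-dimensional case

vec₅ : (a b c d e : F₃) → Vect 5
vec₅ a b c d e = a ∷ b ∷ c ∷ d ∷ e ∷ []

dpolar : Vec F₃ k → Vect k → Vect k → F₃
dpolar ds x y = dform ds (x ⊕ y) -₃ dform ds x -₃ dform ds y

-- Stated in frame coordinates, so that one evaluation for each ε serves every form.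
OnLevel : F₃ → (F₃ → Set) → List (Vect 5) → Set
OnLevel ε R L = All (λ x → dform (ε ∷ hyp 2) x ≡ ε) L
              × AllPairs (λ x y → ¬ Same x y × R (dpolar (ε ∷ hyp 2) x y)) L

onLevel? : ∀ ε {R : F₃ → Set} → (∀ a → Dec (R a)) → ∀ L → Dec (OnLevel ε R L)
onLevel? ε R? L = All.all? (λ x → dform (ε ∷ hyp 2) x ≟ ε) L
  ×-dec AllPairs.allPairs? (λ x y → ¬? (Same? x y) ×-dec R? (dpolar (ε ∷ hyp 2) x y)) L

-- The points ⟨e + w⟩ with q(e) = ε and w in a totally singular plane W of e^⊥: they have value ε,
-- and B(e + w, e + w′) = 2ε is nonzero. The first vector listed is e; W is spanned by two sums of a
-- coordinate vector of value 1 and one of value -1.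
clique₉ : ∀ ε → ¬ ε ≡ 0₃ → ∃[ L ] (OnLevel ε (λ b → ¬ b ≡ 0₃) L × length L ≡ 9)
clique₉ zero ε≢0 = contradiction refl ε≢0
clique₉ (suc zero) _ = L , decide (onLevel? 1₃ (λ b → ¬? (b ≟ 0₃)) L) , refl
  where
  L = vec₅ 0₃ 0₃ 0₃ 1₃ 0₃ ∷ vec₅ 0₃ 1₃ 0₃ 1₃ 1₃ ∷ vec₅ 0₃ 1₃ 0₃ 2₃ 1₃ ∷
      vec₅ 1₃ 0₃ 1₃ 1₃ 0₃ ∷ vec₅ 1₃ 0₃ 1₃ 2₃ 0₃ ∷ vec₅ 1₃ 1₃ 1₃ 1₃ 1₃ ∷
      vec₅ 1₃ 1₃ 1₃ 2₃ 1₃ ∷ vec₅ 1₃ 2₃ 1₃ 1₃ 2₃ ∷ vec₅ 1₃ 2₃ 1₃ 2₃ 2₃ ∷ []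
clique₉ (suc (suc zero)) _ = L , decide (onLevel? 2₃ (λ b → ¬? (b ≟ 0₃)) L) , refl
  where
  L = vec₅ 0₃ 0₃ 0₃ 0₃ 1₃ ∷ vec₅ 0₃ 0₃ 1₃ 1₃ 1₃ ∷ vec₅ 0₃ 0₃ 1₃ 1₃ 2₃ ∷
      vec₅ 1₃ 1₃ 0₃ 0₃ 1₃ ∷ vec₅ 1₃ 1₃ 0₃ 0₃ 2₃ ∷ vec₅ 1₃ 1₃ 1₃ 1₃ 1₃ ∷
      vec₅ 1₃ 1₃ 1₃ 1₃ 2₃ ∷ vec₅ 1₃ 1₃ 2₃ 2₃ 1₃ ∷ vec₅ 1₃ 1₃ 2₃ 2₃ 2₃ ∷ []

-- An orthogonal basis with all values ε: the three coordinate vectors of value ε, and the sum and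
-- difference of the two of value -ε, whose value is -2ε = ε.
coclique₅ : ∀ ε → ¬ ε ≡ 0₃ → ∃[ L ] (OnLevel ε (_≡ 0₃) L × length L ≡ 5)
coclique₅ zero ε≢0 = contradiction refl ε≢0
coclique₅ (suc zero) _ = L , decide (onLevel? 1₃ (_≟ 0₃) L) , refl
  where
  L = vec₅ 0₃ 0₃ 0₃ 1₃ 0₃ ∷ vec₅ 0₃ 0₃ 1₃ 0₃ 1₃ ∷ vec₅ 0₃ 0₃ 1₃ 0₃ 2₃ ∷
      vec₅ 0₃ 1₃ 0₃ 0₃ 0₃ ∷ vec₅ 1₃ 0₃ 0₃ 0₃ 0₃ ∷ []
coclique₅ (suc (suc zero)) _ = L , decide (onLevel? 2₃ (_≟ 0₃) L) , refl
  where
  L = vec₅ 0₃ 0₃ 0₃ 0₃ 1₃ ∷ vec₅ 0₃ 0₃ 1₃ 0₃ 0₃ ∷ vec₅ 0₃ 1₃ 0₃ 1₃ 0₃ ∷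
      vec₅ 0₃ 1₃ 0₃ 2₃ 0₃ ∷ vec₅ 1₃ 0₃ 0₃ 0₃ 0₃ ∷ []

-- For singular `a` and `b`, singularity of `a ⊕ b` means orthogonality. The conditions on `a`
-- precede `b`, so that the exhaustive check discards most `a` early.
NoSingularPlane : F₃ → Vect 5 → Set
NoSingularPlane ε e =
  ∀ a → dpolar ds e a ≡ 0₃ → dform ds a ≡ 0₃ →
  ∀ b → dpolar ds e b ≡ 0₃ → dform ds b ≡ 0₃ → dform ds (a ⊕ b) ≡ 0₃ →
  ∃[ cs ] (¬ cs ≡ 𝟎 × lincomb cs (a ∷ b ∷ []) ≡ 𝟎)
  where ds = ε ∷ hyp 2

noSingularPlane? : ∀ ε e → Dec (NoSingularPlane ε e)
noSingularPlane? ε e =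
  search⇒all? (search-Vect 5) λ a → (dpolar ds e a ≟ 0₃) →-dec (dform ds a ≟ 0₃) →-dec
  search⇒all? (search-Vect 5) λ b → (dpolar ds e b ≟ 0₃) →-dec (dform ds b ≟ 0₃) →-dec
  (dform ds (a ⊕ b) ≟ 0₃) →-dec
  search-Vect 2 λ cs → ¬? (≡-dec _≟_ cs 𝟎) ×-dec ≡-dec _≟_ (lincomb cs (a ∷ b ∷ [])) 𝟎
  where ds = ε ∷ hyp 2

-- The perp of e has minus type.
minusVector : ∀ ε → ¬ ε ≡ 0₃ → ∃[ e ] (dform (ε ∷ hyp 2) e ≡ 2₃ *₃ ε × NoSingularPlane ε e)
minusVector zero             ε≢0 = contradiction refl ε≢0
-- In both cases `e` is a coordinate vector of value -ε. The other four values are ε, ε, 1, -1: an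
-- anisotropic plane and a hyperbolic one.
minusVector (suc zero)       _   = e , refl , decide (noSingularPlane? 1₃ e)
  where e = vec₅ 0₃ 0₃ 1₃ 0₃ 0₃
minusVector (suc (suc zero)) _   = e , refl , decide (noSingularPlane? 2₃ e)
  where e = vec₅ 0₃ 1₃ 0₃ 0₃ 0₃

lincomb-lincomb : ∀ {j} (cs : Vec F₃ j) (es : Vec (Vect k) j) (vs : Vec (Vect n) k) →
                  lincomb cs (Vec.map (λ e → lincomb e vs) es) ≡ lincomb (lincomb cs es) vs
lincomb-lincomb []       []       vs = sym (lincomb-𝟎 vs)
lincomb-lincomb (c ∷ cs) (e ∷ es) vs = trans
  (cong₂ _⊕_ (sym (lincomb-· c e vs)) (lincomb-lincomb cs es vs))
  (sym (lincomb-⊕ (c · e) (lincomb cs es) vs))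

module FiveDimensional (S : QuadraticSpace 5) (nondeg : ∀ x → (∀ y → QuadraticSpace.B S x y ≡ 0₃) → x ≡ 𝟎) where
  open PointGraph S nondeg

  IsPoint : Vect 5 → Set
  IsPoint = Graph.IsVertex (points 2)

  B-lincomb : ∀ {ds : Vec F₃ k} {vs} → Frame ds vs → ∀ x y → B (lincomb x vs) (lincomb y vs) ≡ dpolar ds x y
  B-lincomb {ds = ds} {vs} F x y = begin
    B φx φy
      ≡⟨ decide (all? λ a → all? λ b → all? λ c → c ≟ a +₃ b +₃ c -₃ a -₃ b) (q φx) (q φy) (B φx φy) ⟩
    q φx +₃ q φy +₃ B φx φy -₃ q φx -₃ q φy
      ≡⟨ cong (λ t → t -₃ q φx -₃ q φy) (trans (cong q (lincomb-⊕ x y vs)) (q-⊕ φx φy)) ⟨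
    q (lincomb (x ⊕ y) vs) -₃ q φx -₃ q φy          ≡⟨ cong₂ (λ s t → s -₃ t -₃ q φy) (q-lincomb F (x ⊕ y)) (q-lincomb F x) ⟩
    dform ds (x ⊕ y) -₃ dform ds x -₃ q φy          ≡⟨ cong (λ t → dform ds (x ⊕ y) -₃ dform ds x -₃ t) (q-lincomb F y) ⟩
    dpolar ds x y                                   ∎
    where
    open ≡-Reasoning
    φx = lincomb x vs
    φy = lincomb y vs

  Same-lincomb⁻ : ∀ {ds : Vec F₃ k} {vs} → Frame ds vs → ∀ {x y} → Same (lincomb x vs) (lincomb y vs) → Same x y
  Same-lincomb⁻ {vs = vs} F {x} {y} (c , c≢0 , e) =
    c , c≢0 , lincomb-injective F y (c · x) (trans e (sym (lincomb-· c x vs)))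

  module _ {ε vs} (F : Frame (ε ∷ hyp 2) vs) (ε≢0 : ¬ ε ≡ 0₃) (level⇒point : ∀ {x} → q x ≡ ε → IsPoint x) where

    private
      φ : Vect 5 → Vect 5
      φ y = lincomb y vs

    span : ∀ x → ∃[ y ] x ≡ φ y
    span = spanning nondeg F ℕ.≤-refl

    singular-level : ∀ c d a b {s} → q (lincomb (c ∷ d ∷ []) (φ a ∷ φ b ∷ [])) ≡ 0₃ →
                     (c · a) ⊕ (d · b) ≡ s → dform (ε ∷ hyp 2) s ≡ 0₃
    singular-level c d a b {s} e refl = begin
      dform (ε ∷ hyp 2) s                              ≡⟨ q-lincomb F s ⟨
      q (φ s)                                          ≡⟨ cong (λ t → q (φ ((c · a) ⊕ t))) (⊕-identityʳ (d · b)) ⟨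
      q (φ (lincomb (c ∷ d ∷ []) (a ∷ b ∷ [])))        ≡⟨ cong q (lincomb-lincomb (c ∷ d ∷ []) (a ∷ b ∷ []) vs) ⟨
      q (lincomb (c ∷ d ∷ []) (φ a ∷ φ b ∷ []))        ≡⟨ e ⟩
      0₃                                               ∎
      where open ≡-Reasoning

    -- A totally singular plane is pulled back to frame coordinates, where `none` makes its two
    -- spanning vectors dependent.
    minusPerp : ∀ {e} → NoSingularPlane ε e → ¬ TotallySingularInPerp 2 (φ e)
    minusPerp {e} none (u ∷ v ∷ [] , eu ∷ ev ∷ [] , indep , singular) =
      coordinates (span u) (span v) eu ev indep singular
      where
      coordinates : ∀ {u v} → ∃[ a ] u ≡ φ a → ∃[ b ] v ≡ φ b → B (φ e) u ≡ 0₃ → B (φ e) v ≡ 0₃ →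
                    LinIndep (u ∷ v ∷ []) → (∀ cs → q (lincomb cs (u ∷ v ∷ [])) ≡ 0₃) → ⊥
      coordinates (a , refl) (b , refl) eu ev indep singular =
        let cs , cs≢𝟎 , dep = none
              a (trans (sym (B-lincomb F e a)) eu)
                (singular-level 1₃ 0₃ a b (singular (1₃ ∷ 0₃ ∷ []))
                  (trans (cong₂ _⊕_ (·-identity a) (0·-𝟎 b)) (⊕-identityʳ a)))
              b (trans (sym (B-lincomb F e b)) ev)
                (singular-level 0₃ 1₃ a b (singular (0₃ ∷ 1₃ ∷ []))
                  (trans (cong₂ _⊕_ (0·-𝟎 a) (·-identity b)) (⊕-identityˡ b)))
              (singular-level 1₃ 1₃ a b (singular (1₃ ∷ 1₃ ∷ [])) (cong₂ _⊕_ (·-identity a) (·-identity b)))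
        in cs≢𝟎 (indep cs (trans (lincomb-lincomb cs (a ∷ b ∷ []) vs) (trans (cong φ dep) (lincomb-𝟎 vs))))

    -- A vertex of the other nonzero value -ε could be reflected to a multiple of `φ e`, whose perp
    -- would then contain a totally singular plane.
    point⇒level : ∀ {x} → IsPoint x → q x ≡ ε
    point⇒level {x} (_ , qx≢0 , _ , totallySingular) = decidable-stable (q x ≟ ε) λ qx≢ε →
      let e , qe , none = minusVector ε ε≢0 in
      minusPerp {e} none (transport-perp qx≢0
        (trans (decide (all? λ a → all? λ b →
                  ¬? (a ≟ 0₃) →-dec (¬? (b ≟ 0₃) →-dec (¬? (a ≟ b) →-dec (a ≟ 2₃ *₃ b)))) (q x) ε qx≢0 ε≢0 qx≢ε)
          (sym (trans (q-lincomb F e) qe)))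
        totallySingular)

    onLevel⇒ : ∀ {R L} → OnLevel ε R L → VertexList (points 2) (List.map φ L)
                         × AllPairs (λ x y → R (B x y)) (List.map φ L)
    onLevel⇒ {R} (on , rel) =
      ( All.map⁺ (All.map (λ {y} qy → level⇒point (trans (q-lincomb F y) qy)) on)
      , AllPairs.map⁺ (AllPairs.map (λ (x≁y , _) φx~φy → x≁y (Same-lincomb⁻ F φx~φy)) rel))
      , AllPairs.map⁺ (AllPairs.map (λ {x} {y} (_ , r) → subst R (sym (B-lincomb F x y)) r) rel)

    9≤cliqueNumber : ∀ {ω} → IsCliqueNumber (points 2) ω → 9 ≤ ω
    9≤cliqueNumber {ω} (_ , max) = bound (clique₉ ε ε≢0)
      where
      bound : ∃[ L ] (OnLevel ε (λ b → ¬ b ≡ 0₃) L × length L ≡ 9) → 9 ≤ ω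
      bound (L , on , ∣L∣≡9) = subst (_≤ ω) (trans (length-map φ L) ∣L∣≡9)
        (max (List.map φ L) (onLevel⇒ {λ b → ¬ b ≡ 0₃} on))

    5≤cocliqueNumber : ∀ {α} → IsCocliqueNumber (points 2) α → 5 ≤ α
    5≤cocliqueNumber {α} (_ , max) = bound (coclique₅ ε ε≢0)
      where
      bound : ∃[ L ] (OnLevel ε (_≡ 0₃) L × length L ≡ 5) → 5 ≤ α
      bound (L , on , ∣L∣≡5) = subst (_≤ α) (trans (length-map φ L) ∣L∣≡5)
        (max (List.map φ L) (let vL , L⊥ = onLevel⇒ {_≡ 0₃} on in vL , AllPairs.map (λ e ¬e → ¬e e) L⊥))

    order≤45 : ∀ {N} → HasOrder (points 2) N → N ≤ 45
    -- Twice 45 is 3^2 (3^2 + 1).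
    order≤45 {N} hasOrder = ℕ.*-cancelˡ-≤ {N} {45} 2 (order-upper-bound F ε≢0 ℕ.≤-refl point⇒level hasOrder)

    nonSeparating : NonSeparating (points 2)
    nonSeparating = combine cliqueNumber cocliqueNumber order
      where
      -- Plus type is not searched for directly: being a vertex is decided by the value of `q`
      -- alone.
      open Extremal {2} (λ x → map′ level⇒point point⇒level (q x ≟ ε))
      combine : ∃ (IsCliqueNumber (points 2)) → ∃ (IsCocliqueNumber (points 2)) → ∃ (HasOrder (points 2)) →
                NonSeparating (points 2)
      combine (ω , isω) (α , isα) (N , hasOrder) = ω , α , N , isω , isα , hasOrder ,
        ℕ.≤-trans (order≤45 hasOrder) (ℕ.*-mono-≤ (9≤cliqueNumber isω) (5≤cocliqueNumber isα))

  five-dimensional : NonSeparating (points 2)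
  five-dimensional = withFrame (hyperbolicFrame⁺ nondeg 2 ℕ.≤-refl)
    where
    withFrame : ∃[ ε ] ∃[ vs ] Frame (ε ∷ hyp 2) vs → NonSeparating (points 2)
    withFrame (ε , z ∷ vs , F@(frame ε≢0 _ _ _)) = nonSeparating F ε≢0 (level⇒vertex F)

theorem3p2 : (m : ℕ) → 2 ≤ m → (Q : QuadForm (2 * m + 1)) → Nondegenerate Q →
    (NonSeparating (NOPlus m Q) ⇔ m ≡ 2)
theorem3p2 m 2≤m Q nondeg = mk⇔ (to m 2≤m Q nondeg)
  λ { refl → fromPoints 2 Q nondeg (FiveDimensional.five-dimensional (quadraticSpace Q) nondeg) }
  where
  -- Stated for variable m, since at a numeral the conversion check unfolds all sums over coordinates.
  toPoints : ∀ m Q nondeg → NonSeparating (NOPlus m Q) → NonSeparating (PointGraph.points (quadraticSpace Q) nondeg m)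
  toPoints m Q nondeg nonsep = nonsep
  fromPoints : ∀ m Q nondeg → NonSeparating (PointGraph.points (quadraticSpace Q) nondeg m) → NonSeparating (NOPlus m Q)
  fromPoints m Q nondeg nonsep = nonsep
  dimension : ∀ m → 2 * m + 1 ≡ suc (m * 2)
  dimension = ℕ-Solver.solve-∀
  to : ∀ m → 2 ≤ m → (Q : QuadForm (2 * m + 1)) → Nondegenerate Q → NonSeparating (NOPlus m Q) → m ≡ 2
  to (suc (suc zero))      _        Q nondeg _      = refl
  to (suc zero)            (s≤s ()) Q nondeg _
  to m@(suc (suc (suc j))) _        Q nondeg nonsep = contradiction (toPoints m Q nondeg nonsep)
    (PointGraph.separating (quadraticSpace Q) nondeg j (dimension m))
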